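{- Let $\Delta$ be an irreducible reduced crystallographic root system with simple roots $\Pi$ and Weyl group $W$, and consider a $1$-standard $\mathbb Z$-grading with $\Pi=\Pi(0)\sqcup\{\tilde\alpha\}$, i.e. $\Delta(i)=\{\gamma\in\Delta\mid [\gamma:\tilde\alpha]=i\}$. For $w\in W^0$ and $\alpha\in\Pi$ let $k_\alpha(w)=[w^{ -1}(\alpha):\tilde\alpha]$ and define $\eta:W^0\to\mathbb Z^{\Pi}$, $\eta(w)=(k_\alpha(w))_{\alpha\in\Pi}$. Then: (i) $\eta$ is injective; (ii) $\eta(W^0_{\min})=\{\eta(w)\mid w\in W^0,\ k_\alpha(w)\ge -1\ \text{for all }\alpha\in\Pi\}$; (iii) $\eta(W^0_{\max})=\{\eta(w)\mid w\in W^0,\ k_\alpha(w)\le 1\ \text{for all }\alpha\in\Pi\}$.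
   Context: $[\gamma:\alpha]$ denotes the coefficient of the simple root $\alpha$ in $\gamma$. The positive system $\Delta^+=\Delta(0)^+\sqcup\bigsqcup_{i\ge1}\Delta(i)$. Order: $\mu\preccurlyeq\gamma$ iff $\gamma-\mu$ is a nonnegative integer combination of simple roots; lower ideals of $\Delta(1)$ are its downward closed subsets; $I^c=\Delta(1)\setminus I$; $\Delta(\ge1)=\bigsqcup_{j\ge1}\Delta(j)$. $N(w)=\{\gamma\in\Delta^+\mid w(\gamma)\in-\Delta^+\}$. $W^0=\{w\in W\mid w(\alpha)\in\Delta^+\ \forall\alpha\in\Delta(0)^+\}$. For $J\subset\Delta^+$: $J^1=J$, $J^k=(J+J^{k-1})\cap\Delta$, $\langle J\rangle=\bigcup_{k\ge1}J^k$. $w_{I,\min}$ is the unique $w\in W$ with $N(w)=\langle I\rangle$, $w_{I,\max}$ the unique $w\in W$ with $N(w)=\Delta(\ge1)\setminus\langle I^c\rangle$; $W^0_{\min}=\{w_{I,\min}\}$ and $W^0_{\max}=\{w_{I,\max}\}$, $I$ ranging over lower ideals of $\Delta(1)$. -}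

module Defs where

open import Data.Nat using (ℕ)
open import Data.Integer using (ℤ; 0ℤ; 1ℤ; -1ℤ; _+_; _-_; _*_; -_; _≤_; +_)
open import Data.Fin using (Fin; _≟_)
open import Data.Vec using (Vec; lookup; tabulate; zipWith; foldr′; map)
open import Data.List using (List; []; _∷_; reverse)
open import Data.List.Membership.Propositional using (_∈_)
open import Data.Product using (Σ; _×_)
open import Data.Sum using (_⊎_)
open import Data.Bool using (Bool; true; false; if_then_else_)
open import Relation.Binary.PropositionalEquality using (_≡_)
open import Relation.Nullary using (¬_)
open import Relation.Nullary.Decidable using (⌊_⌋)

-- Root systems via (generalized) Cartan matrices.
-- A root system of rank n with base Π = {α_0,…,α_{n-1}} is encoded by its
-- Cartan matrix C i j = ⟨α_i , α_j^∨⟩.  Vectors of ℤ^n are coordinates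
-- w.r.t. the simple roots, so [γ : α_i] = lookup γ i.

record IsGCM {n : ℕ} (C : Fin n → Fin n → ℤ) : Set where
  field
    diag    : ∀ i → C i i ≡ + 2
    offdiag : ∀ i j → ¬ (i ≡ j) → C i j ≤ 0ℤ
    zeroSym : ∀ i j → C i j ≡ 0ℤ → C j i ≡ 0ℤ

Indecomposable : {n : ℕ} → (Fin n → Fin n → ℤ) → Set
Indecomposable {n} C =
  (S : Fin n → Bool) →
  (∀ i j → S i ≡ true → S j ≡ false → C i j ≡ 0ℤ) →
  (∀ i → S i ≡ true) ⊎ (∀ i → S i ≡ false)

module RootSystem {n : ℕ} (C : Fin n → Fin n → ℤ) where

  V : Set
  V = Vec ℤ n

  e : Fin n → V
  e i = tabulate (λ j → if ⌊ j ≟ i ⌋ then 1ℤ else 0ℤ)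

  _⊕_ : V → V → V
  _⊕_ = zipWith _+_

  neg : V → V
  neg = map (λ x → - x)

  pair : V → Fin n → ℤ
  pair v j = foldr′ _+_ 0ℤ (tabulate (λ i → lookup v i * C i j))

  s : Fin n → V → V
  s j v = zipWith _-_ v (map (pair v j *_) (e j))

  -- Weyl group elements as words in simple reflections;
  -- (i ∷ w) stands for s_i ∘ w.
  Word : Set
  Word = List (Fin n)

  act : Word → V → V
  act []      v = v
  act (i ∷ w) v = s i (act w v)

  inv : Word → Word
  inv = reverse

  -- equality in W (W acts faithfully on the root lattice)
  _≈W_ : Word → Word → Set
  w ≈W w' = ∀ v → act w v ≡ act w' v

  IsRoot : V → Set
  IsRoot v = Σ Word (λ w → Σ (Fin n) (λ i → act w (e i) ≡ v))

  -- Δ is finite (⇔ C is of finite type)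
  FiniteRoots : Set
  FiniteRoots = Σ (List V) (λ L → ∀ v → IsRoot v → v ∈ L)

  PosRoot : V → Set
  PosRoot v = IsRoot v × (∀ i → 0ℤ ≤ lookup v i)

  _≼_ : V → V → Set
  μ ≼ γ = ∀ i → lookup μ i ≤ lookup γ i

  N : Word → V → Set
  N w γ = PosRoot γ × PosRoot (neg (act w γ))

  data Gen (J : V → Set) : V → Set where
    base : ∀ {γ} → J γ → Gen J γ
    add  : ∀ {β δ} → J β → Gen J δ → IsRoot (β ⊕ δ) → Gen J (β ⊕ δ)

  module Graded (p : Fin n) where

    Δ0⁺ : V → Set
    Δ0⁺ γ = PosRoot γ × lookup γ p ≡ 0ℤ

    Δ1 : V → Set
    Δ1 γ = IsRoot γ × lookup γ p ≡ 1ℤ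

    Δ≥1 : V → Set
    Δ≥1 γ = IsRoot γ × 1ℤ ≤ lookup γ p

    InW0 : Word → Set
    InW0 w = ∀ α → Δ0⁺ α → PosRoot (act w α)

    k : Fin n → Word → ℤ
    k α w = lookup (act (inv w) (e α)) p

    η : Word → V
    η w = tabulate (λ α → k α w)

    LowerIdeal : (V → Set) → Set
    LowerIdeal I = (∀ γ → I γ → Δ1 γ) × (∀ μ γ → Δ1 μ → I γ → μ ≼ γ → I μ)

    Compl : (V → Set) → V → Set
    Compl I γ = Δ1 γ × ¬ I γ

    IsMinFor : Word → (V → Set) → Set
    IsMinFor w I = ∀ γ → (N w γ → Gen I γ) × (Gen I γ → N w γ)

    IsMaxFor : Word → (V → Set) → Set
    IsMaxFor w I = ∀ γ → (N w γ → Δ≥1 γ × ¬ Gen (Compl I) γ)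
                       × (Δ≥1 γ × ¬ Gen (Compl I) γ → N w γ)

    EtaInjective : Set
    EtaInjective = ∀ w w' → InW0 w → InW0 w' → η w ≡ η w' → w ≈W w'

    EtaMin : Set₁
    EtaMin = ∀ κ →
      ((Σ (V → Set) (λ I → LowerIdeal I × Σ Word (λ w → IsMinFor w I × η w ≡ κ)))
        → Σ Word (λ w → InW0 w × (∀ α → -1ℤ ≤ k α w) × η w ≡ κ))
      × (Σ Word (λ w → InW0 w × (∀ α → -1ℤ ≤ k α w) × η w ≡ κ)
        → Σ (V → Set) (λ I → LowerIdeal I × Σ Word (λ w → IsMinFor w I × η w ≡ κ)))

    EtaMax : Set₁
    EtaMax = ∀ κ →
      ((Σ (V → Set) (λ I → LowerIdeal I × Σ Word (λ w → IsMaxFor w I × η w ≡ κ)))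
        → Σ Word (λ w → InW0 w × (∀ α → k α w ≤ 1ℤ) × η w ≡ κ))
      × (Σ Word (λ w → InW0 w × (∀ α → k α w ≤ 1ℤ) × η w ≡ κ)
        → Σ (V → Set) (λ I → LowerIdeal I × Σ Word (λ w → IsMaxFor w I × η w ≡ κ)))

{-# OPTIONS --safe #-}

-- The finitely many functionals in the W-orbit of the coordinate functionals give, as a sum of squares, a
-- W-invariant positive definite form B with 2 B(x, α_j) = ⟨x, α_j^∨⟩ B(α_j, α_j).  From B one obtains that
-- every root has coefficients of one sign, that x − y is a root or 0 for roots with B(x, y) > 0, and that an
-- element of W keeping all simple roots positive is the identity.
--
-- The degree of w⁻¹(v) is linear in v and given by η(w) on the simple roots.  So if η(w) = η(w′), then w′⁻¹w
-- preserves degrees; for w, w′ ∈ W⁰ it then keeps simple roots positive, whence (i).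
--
-- For (ii) and (iii), let f be additive with f ≥ −1 on simple roots (f(v) is the degree of w⁻¹(v), respectively
-- its opposite).  By induction on the height, every positive root with f ≤ −1 lies in the set generated by the
-- positive roots with f = −1: a root of this set stays in it after adding a positive root θ with f(θ) ≥ 0 as
-- long as the sum is a root with f ≤ −1, because if (β + δ) + θ is a root, so is β + θ or δ + θ.  Conversely,
-- |k_α(w)| ≥ 2 of the wrong sign would write the simple root α as a sum of two positive roots.
module Submission where

open import Defs
open import Data.Bool using (if_then_else_)
open import Data.Empty using (⊥; ⊥-elim)
open import Data.Nat as ℕ using (ℕ; zero; suc)
import Data.Nat.Properties as ℕₚ
open import Data.Integer
  using (ℤ; 0ℤ; 1ℤ; -1ℤ; _+_; _-_; _*_; -_; _≤_; -[1+_]; +≤+; -≤-; -≤+; ∣_∣; NonZero; nonNegative; ≢-nonZero)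
  renaming (+_ to pos)
import Data.Integer.Properties as ℤₚ
open import Data.Integer.Divisibility.Signed
  using (_∣_; divides; ∣-refl; ∣m∣n⇒∣m+n; ∣m∣n⇒∣m-n; ∣m⇒∣m*n; ∣n⇒∣m*n; ∣m⇒∣-m)
open import Data.Integer.Tactic.RingSolver using (solve-∀)
open import Data.Fin using (Fin; zero; suc; _≟_)
import Data.Fin.Properties as Finₚ
open import Data.Vec using (Vec; []; _∷_; lookup; tabulate; foldr′; map; replicate)
import Data.Vec.Properties as Vecₚ
open import Data.List as List using (List; []; _∷_; initLast; _∷ʳ′_)
import Data.List.Properties as Listₚ
open import Data.List.Membership.Propositional using (_∈_; find; lose)
open import Data.List.Membership.Propositional.Properties
  using (∈-filter⁺; ∈-map⁺; ∈-map⁻; ∈-concat⁺′; ∈-tabulate⁺; ∈-cartesianProductWith⁺)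
open import Data.List.Membership.Propositional.Properties.WithK using (unique∧set⇒bag)
import Data.List.Membership.DecPropositional as DecMembership
open import Data.List.Relation.Binary.BagAndSetEquality using (∼bag⇒↭)
open import Data.List.Relation.Binary.Permutation.Propositional as ↭ using (_↭_)
open import Data.List.Relation.Unary.All as All using (All; []; _∷_)
import Data.List.Relation.Unary.All.Properties as Allₚ
open import Data.List.Relation.Unary.Any using (here; there)
open import Data.List.Relation.Unary.Unique.Propositional using (Unique; []; _∷_)
import Data.List.Relation.Unary.Unique.Propositional.Properties as Uniqueₚ
open import Data.Product using (∃; _×_; _,_; proj₁; proj₂)
open import Data.Sum using (_⊎_; inj₁; inj₂; [_,_]′)
open import Function using (_∘_; id; mk⇔)
open import Relation.Binary.Definitions using (DecidableEquality)
open import Relation.Binary.PropositionalEquality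
  using (_≡_; _≢_; refl; sym; trans; cong; cong₂; subst; subst₂; module ≡-Reasoning)
open import Relation.Nullary using (¬_; yes; no; contradiction; ¬?)
open import Relation.Nullary.Decidable using (⌊_⌋)
open import Algebra.Properties.AbelianGroup ℤₚ.+-0-abelianGroup using (∙-cancelˡ; xyx⁻¹≈y)
open import Algebra.Properties.CommutativeSemigroup ℤₚ.+-commutativeSemigroup
  using () renaming (interchange to +-interchange; x∙yz≈y∙xz to x+yz≡y+xz)
open import Algebra.Properties.CommutativeSemigroup ℤₚ.*-commutativeSemigroup
  using () renaming (x∙yz≈y∙xz to x*yz≡y*xz)
open import Algebra.Properties.Semiring.Sum ℤₚ.+-*-semiring
  using (sum; sum-cong-≗; ∑-distrib-+; *-distribˡ-sum)

-- Integer inequalities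

≤0⊎1≤ : ∀ x → x ≤ 0ℤ ⊎ 1ℤ ≤ x
≤0⊎1≤ (pos zero)    = inj₁ (+≤+ ℕ.z≤n)
≤0⊎1≤ (pos (suc m)) = inj₂ (+≤+ (ℕ.s≤s ℕ.z≤n))
≤0⊎1≤ -[1+ m ]      = inj₁ -≤+

1≰0 : ¬ (1ℤ ≤ 0ℤ)
1≰0 (+≤+ ())

0≤1 : 0ℤ ≤ 1ℤ
0≤1 = +≤+ ℕ.z≤n

+-nonneg : ∀ {x y} → 0ℤ ≤ x → 0ℤ ≤ y → 0ℤ ≤ x + y
+-nonneg = ℤₚ.+-mono-≤

*-nonneg : ∀ {x y} → 0ℤ ≤ x → 0ℤ ≤ y → 0ℤ ≤ x * y
*-nonneg {x} {y} 0≤x 0≤y =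
  subst (_≤ x * y) (ℤₚ.*-zeroʳ x) (ℤₚ.*-monoˡ-≤-nonNeg x {{nonNegative 0≤x}} 0≤y)

square-nonneg : ∀ x → 0ℤ ≤ x * x
square-nonneg (pos m)  = *-nonneg {pos m} (+≤+ ℕ.z≤n) (+≤+ ℕ.z≤n)
square-nonneg -[1+ m ] = +≤+ ℕ.z≤n

square≤0⇒≡0 : ∀ x → x * x ≤ 0ℤ → x ≡ 0ℤ
square≤0⇒≡0 (pos zero) _ = refl
square≤0⇒≡0 (pos (suc m)) (+≤+ ())
square≤0⇒≡0 -[1+ m ] (+≤+ ())

neg-nonneg : ∀ {x} → x ≤ 0ℤ → 0ℤ ≤ - x
neg-nonneg = ℤₚ.neg-mono-≤

neg-nonpos : ∀ {x} → 0ℤ ≤ x → - x ≤ 0ℤ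
neg-nonpos = ℤₚ.neg-mono-≤

0≤-neg⁻ : ∀ {x} → 0ℤ ≤ - x → x ≤ 0ℤ
0≤-neg⁻ {x} p = subst (_≤ 0ℤ) (ℤₚ.neg-involutive x) (neg-nonpos p)

1≤⇒0≤ : ∀ {x} → 1ℤ ≤ x → 0ℤ ≤ x
1≤⇒0≤ = ℤₚ.≤-trans 0≤1

0≰-1 : ¬ (0ℤ ≤ -1ℤ)
0≰-1 ()

nonneg*nonpos : ∀ {x y} → 0ℤ ≤ x → y ≤ 0ℤ → x * y ≤ 0ℤ
nonneg*nonpos {x} {y} 0≤x y≤0 =
  subst (x * y ≤_) (ℤₚ.*-zeroʳ x) (ℤₚ.*-monoˡ-≤-nonNeg x {{nonNegative 0≤x}} y≤0)

nonpos*nonneg : ∀ {x y} → x ≤ 0ℤ → 0ℤ ≤ y → x * y ≤ 0ℤ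
nonpos*nonneg {x} {y} x≤0 0≤y = subst (_≤ 0ℤ) (ℤₚ.*-comm y x) (nonneg*nonpos 0≤y x≤0)

∣⇒≤ : ∀ {k x} → 1ℤ ≤ k → 1ℤ ≤ x → k ∣ x → k ≤ x
∣⇒≤ {k} {x} 1≤k 1≤x (divides q refl) with ≤0⊎1≤ q
... | inj₁ q≤0 = contradiction (ℤₚ.≤-trans 1≤x (nonpos*nonneg q≤0 (1≤⇒0≤ 1≤k))) 1≰0
... | inj₂ 1≤q = subst (_≤ q * k) (ℤₚ.*-identityˡ k) (ℤₚ.*-monoʳ-≤-nonNeg k {{nonNegative (1≤⇒0≤ 1≤k)}} 1≤q)

double-nonpos : ∀ {x} → pos 2 * x ≤ 0ℤ → x ≤ 0ℤ
double-nonpos {x} = ℤₚ.*-cancelˡ-≤-pos x 0ℤ (pos 2)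

nonneg-unit : ∀ {x} y → 0ℤ ≤ x → x * y ≡ 1ℤ → x ≡ 1ℤ
nonneg-unit {pos m} y _ eq =
  cong pos (ℕₚ.m*n≡1⇒m≡1 m ∣ y ∣ (trans (sym (ℤₚ.abs-* (pos m) y)) (cong ∣_∣ eq)))

1≤⇒≡1⊎2≤ : ∀ {x} → 1ℤ ≤ x → x ≡ 1ℤ ⊎ pos 2 ≤ x
1≤⇒≡1⊎2≤ {pos 1}              _ = inj₁ refl
1≤⇒≡1⊎2≤ {pos (suc (suc m))}  _ = inj₂ (+≤+ (ℕ.s≤s (ℕ.s≤s ℕ.z≤n)))
1≤⇒≡1⊎2≤ {pos zero} (+≤+ ())

infix 8 _⁺
_⁺ : ℤ → ℤ
pos m ⁺    = pos m
-[1+ m ] ⁺ = 0ℤ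

⁺-nonneg : ∀ x → 0ℤ ≤ x ⁺
⁺-nonneg (pos m)  = +≤+ ℕ.z≤n
⁺-nonneg -[1+ m ] = ℤₚ.≤-refl

⁺-cases : ∀ x → x ⁺ ≡ x ⊎ x ⁺ ≡ 0ℤ
⁺-cases (pos m)  = inj₁ refl
⁺-cases -[1+ m ] = inj₂ refl

⁺-difference : ∀ x → x ≡ x ⁺ - (- x) ⁺
⁺-difference (pos zero)    = refl
⁺-difference (pos (suc m)) = sym (ℤₚ.+-identityʳ (pos (suc m)))
⁺-difference -[1+ m ]      = refl

⁺-disjoint : ∀ x → x ⁺ ≡ 0ℤ ⊎ (- x) ⁺ ≡ 0ℤ
⁺-disjoint (pos zero)    = inj₁ refl
⁺-disjoint (pos (suc m)) = inj₂ refl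
⁺-disjoint -[1+ m ]      = inj₁ refl

⁺≡0⇒nonpos : ∀ x → x ⁺ ≡ 0ℤ → x ≤ 0ℤ
⁺≡0⇒nonpos (pos zero) _ = ℤₚ.≤-refl
⁺≡0⇒nonpos -[1+ m ]   _ = -≤+

≤-1⊎0≤ : ∀ x → x ≤ -1ℤ ⊎ 0ℤ ≤ x
≤-1⊎0≤ (pos m)  = inj₂ (+≤+ ℕ.z≤n)
≤-1⊎0≤ -[1+ m ] = inj₁ (-≤- ℕ.z≤n)

-1≤⊎2≤- : ∀ x → -1ℤ ≤ x ⊎ pos 2 ≤ - x
-1≤⊎2≤- (pos m)        = inj₁ -≤+
-1≤⊎2≤- -[1+ zero ]    = inj₁ ℤₚ.≤-refl
-1≤⊎2≤- -[1+ suc m ]   = inj₂ (+≤+ (ℕ.s≤s (ℕ.s≤s ℕ.z≤n)))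

≤1⊎2≤ : ∀ x → x ≤ 1ℤ ⊎ pos 2 ≤ x
≤1⊎2≤ x with ≤0⊎1≤ x
... | inj₁ x≤0 = inj₁ (ℤₚ.≤-trans x≤0 0≤1)
... | inj₂ 1≤x with 1≤⇒≡1⊎2≤ 1≤x
...   | inj₁ refl = inj₁ ℤₚ.≤-refl
...   | inj₂ 2≤x  = inj₂ 2≤x

2≰1 : ¬ (pos 2 ≤ 1ℤ)
2≰1 (+≤+ (ℕ.s≤s ()))

i≤i+j : ∀ i {j} → 0ℤ ≤ j → i ≤ i + j
i≤i+j i {j} 0≤j = subst (_≤ i + j) (ℤₚ.+-identityʳ i) (ℤₚ.+-monoʳ-≤ i 0≤j)

nonneg-sum≡0ˡ : ∀ {x y} → 0ℤ ≤ x → 0ℤ ≤ y → x + y ≡ 0ℤ → x ≡ 0ℤ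
nonneg-sum≡0ˡ {x} 0≤x 0≤y eq = ℤₚ.≤-antisym (subst (x ≤_) eq (i≤i+j x 0≤y)) 0≤x

-- Finite sums

sum-nonneg : ∀ {n} (f : Fin n → ℤ) → (∀ i → 0ℤ ≤ f i) → 0ℤ ≤ sum f
sum-nonneg {zero}  f 0≤f = ℤₚ.≤-refl
sum-nonneg {suc n} f 0≤f = +-nonneg (0≤f zero) (sum-nonneg (f ∘ suc) (0≤f ∘ suc))

sum-nonpos : ∀ {n} (f : Fin n → ℤ) → (∀ i → f i ≤ 0ℤ) → sum f ≤ 0ℤ
sum-nonpos {zero}  f f≤0 = ℤₚ.≤-refl
sum-nonpos {suc n} f f≤0 = ℤₚ.+-mono-≤ (f≤0 zero) (sum-nonpos (f ∘ suc) (f≤0 ∘ suc))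

∣-sum : ∀ {n} k (f : Fin n → ℤ) → (∀ i → k ∣ f i) → k ∣ sum f
∣-sum {zero}  k f k∣f = divides 0ℤ refl
∣-sum {suc n} k f k∣f = ∣m∣n⇒∣m+n (k∣f zero) (∣-sum k (f ∘ suc) (k∣f ∘ suc))

sum-zero : ∀ {n} (f : Fin n → ℤ) → (∀ i → f i ≡ 0ℤ) → sum f ≡ 0ℤ
sum-zero {zero}  f f≡0 = refl
sum-zero {suc n} f f≡0 = cong₂ _+_ (f≡0 zero) (sum-zero (f ∘ suc) (f≡0 ∘ suc))

sum-single : ∀ {n} (f : Fin n → ℤ) j → (∀ i → i ≢ j → f i ≡ 0ℤ) → sum f ≡ f j
sum-single f zero    f≡0 =
  trans (cong (f zero +_) (sum-zero (f ∘ suc) (λ i → f≡0 (suc i) λ ()))) (ℤₚ.+-identityʳ _)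
sum-single f (suc j) f≡0 =
  trans (cong₂ _+_ (f≡0 zero λ ())
            (sum-single (f ∘ suc) j (λ i i≢j → f≡0 (suc i) (i≢j ∘ Finₚ.suc-injective))))
    (ℤₚ.+-identityˡ _)

sum-positive⇒∃ : ∀ {n} (f : Fin n → ℤ) → 1ℤ ≤ sum f → ∃ λ i → 1ℤ ≤ f i
sum-positive⇒∃ {zero}  f p = contradiction p 1≰0
sum-positive⇒∃ {suc n} f p with ≤0⊎1≤ (f zero)
... | inj₂ q = zero , q
... | inj₁ q with ≤0⊎1≤ (sum (f ∘ suc))
...   | inj₁ r = contradiction (ℤₚ.≤-trans p (ℤₚ.+-mono-≤ q r)) 1≰0
...   | inj₂ r with sum-positive⇒∃ (f ∘ suc) r
...     | i , s = suc i , s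

foldr-tabulate : ∀ {n} (f : Fin n → ℤ) → foldr′ _+_ 0ℤ (tabulate f) ≡ sum f
foldr-tabulate {zero}  f = refl
foldr-tabulate {suc n} f = cong (f zero +_) (foldr-tabulate (f ∘ suc))

-- Sums over lists and their rearrangement.

listSum : {A : Set} → (A → ℤ) → List A → ℤ
listSum f []       = 0ℤ
listSum f (x ∷ xs) = f x + listSum f xs

module _ {A : Set} where

  listSum-cong : {f g : A → ℤ} → (∀ x → f x ≡ g x) → ∀ xs → listSum f xs ≡ listSum g xs
  listSum-cong f≗g []       = refl
  listSum-cong f≗g (x ∷ xs) = cong₂ _+_ (f≗g x) (listSum-cong f≗g xs)

  listSum-map : {B : Set} (f : B → ℤ) (g : A → B) → ∀ xs →
                listSum f (List.map g xs) ≡ listSum (f ∘ g) xs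
  listSum-map f g []       = refl
  listSum-map f g (x ∷ xs) = cong (f (g x) +_) (listSum-map f g xs)

  listSum-↭ : (f : A → ℤ) → ∀ {xs ys} → xs ↭ ys → listSum f xs ≡ listSum f ys
  listSum-↭ f ↭.refl         = refl
  listSum-↭ f (↭.prep x p)   = cong (f x +_) (listSum-↭ f p)
  listSum-↭ f {_ ∷ _ ∷ xs} {_ ∷ _ ∷ ys} (↭.swap x y p) =
    trans (cong (λ t → f x + (f y + t)) (listSum-↭ f p)) (x+yz≡y+xz (f x) (f y) (listSum f ys))
  listSum-↭ f (↭.trans p q)  = trans (listSum-↭ f p) (listSum-↭ f q)

  listSum-nonneg : (f : A → ℤ) → (∀ x → 0ℤ ≤ f x) → ∀ xs → 0ℤ ≤ listSum f xs
  listSum-nonneg f 0≤f []       = ℤₚ.≤-refl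
  listSum-nonneg f 0≤f (x ∷ xs) = +-nonneg (0≤f x) (listSum-nonneg f 0≤f xs)

  term≤listSum : (f : A → ℤ) → (∀ x → 0ℤ ≤ f x) → ∀ {x xs} → x ∈ xs → f x ≤ listSum f xs
  term≤listSum f 0≤f {x} {_ ∷ xs} (here refl) =
    subst (_≤ f x + listSum f xs) (ℤₚ.+-identityʳ _) (ℤₚ.+-monoʳ-≤ (f x) (listSum-nonneg f 0≤f xs))
  term≤listSum f 0≤f {x} {y ∷ xs} (there p) =
    subst (_≤ f y + listSum f xs) (ℤₚ.+-identityˡ _) (ℤₚ.+-mono-≤ (0≤f y) (term≤listSum f 0≤f p))

  -- An involution is injective, so the image list has no repetitions and, by closedness, the same
  -- members as `xs`; repetition-free lists with the same members are permutations of each other.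
  -- This reindexes the sum that defines the invariant form.
  involution-permutes : (g : A → A) → (∀ x → g (g x) ≡ x) → ∀ {xs} → Unique xs →
                        (∀ {x} → x ∈ xs → g x ∈ xs) → List.map g xs ↭ xs
  involution-permutes g inv {xs} uniq closed =
    ∼bag⇒↭ (unique∧set⇒bag (Uniqueₚ.map⁺ g-injective uniq) uniq (mk⇔ to from))
    where
    g-injective : ∀ {x y} → g x ≡ g y → x ≡ y
    g-injective {x} {y} eq = trans (sym (inv x)) (trans (cong g eq) (inv y))
    to : ∀ {x} → x ∈ List.map g xs → x ∈ xs
    to p with ∈-map⁻ g p
    ... | _ , q , refl = closed q
    from : ∀ {x} → x ∈ xs → x ∈ List.map g xs
    from {x} p = subst (_∈ List.map g xs) (inv x) (∈-map⁺ g (closed p))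

-- Closing a finite set under finitely many maps.

vectorsFrom : List ℤ → ∀ n → List (Vec ℤ n)
vectorsFrom es zero    = [] ∷ []
vectorsFrom es (suc n) = List.cartesianProductWith _∷_ es (vectorsFrom es n)

∈-vectorsFrom : ∀ {es n} (v : Vec ℤ n) → (∀ i → lookup v i ∈ es) → v ∈ vectorsFrom es n
∈-vectorsFrom []      _  = here refl
∈-vectorsFrom (x ∷ v) ∈es =
  ∈-cartesianProductWith⁺ _∷_ (∈es zero) (∈-vectorsFrom v (∈es ∘ suc))

module Closure {A : Set} (_≟A_ : DecidableEquality A) {m : ℕ} (g : Fin m → A → A)
               (P : A → Set) (P-closed : ∀ j {x} → P x → P (g j x)) where

  open DecMembership _≟A_ using (_∈?_)

  Closed : List A → Set
  Closed R = ∀ j {x} → x ∈ R → g j x ∈ R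

  -- M holds the elements that can still be added to R, which bounds the number of steps.
  saturate : ∀ k M → List.length M ℕ.≤ k → ∀ R → Unique R → All P R →
             (∀ {x} → P x → x ∈ R ⊎ x ∈ M) →
             ∃ λ R′ → Unique R′ × (∀ {x} → x ∈ R → x ∈ R′) × Closed R′
  saturate k M M≤k R uniq allP bound
    with All.all? (λ x → Finₚ.all? (λ j → g j x ∈? R)) R
  ... | yes closed = R , uniq , id , λ j x∈R → All.lookup closed x∈R j
  ... | no ¬closed
    with find (Allₚ.¬All⇒Any¬ (λ x → Finₚ.all? (λ j → g j x ∈? R)) R ¬closed)
  ... | x , x∈R , ¬∀
    with Finₚ.¬∀⟶∃¬ m _ (λ j → g j x ∈? R) ¬∀
  ... | j , y∉R = extend k M≤k
    where
    y = g j x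
    Py : P y
    Py = P-closed j (All.lookup allP x∈R)
    ≢y? = λ z → ¬? (z ≟A y)
    M′ = List.filter ≢y? M
    y∈M : y ∈ M
    y∈M = [ (λ y∈R → contradiction y∈R y∉R) , id ]′ (bound Py)
    M′<M : List.length M′ ℕ.< List.length M
    M′<M = Listₚ.filter-notAll ≢y? M (lose y∈M (λ ¬refl → ¬refl refl))
    bound′ : ∀ {z} → P z → z ∈ y ∷ R ⊎ z ∈ M′
    bound′ {z} Pz with z ≟A y
    ... | yes z≡y = inj₁ (here z≡y)
    ... | no  z≢y = [ inj₁ ∘ there , (λ z∈M → inj₂ (∈-filter⁺ ≢y? z∈M z≢y)) ]′ (bound Pz)
    -- `k` is split only once a new element `y` is known: `y` lies in `M`, so the bound 0 is
    -- impossible, and otherwise the strictly shorter `M′` takes over.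
    extend : ∀ k → List.length M ℕ.≤ k →
             ∃ λ R′ → Unique R′ × (∀ {x} → x ∈ R → x ∈ R′) × Closed R′
    extend zero    M≤0 = contradiction (ℕₚ.<-≤-trans M′<M M≤0) λ ()
    extend (suc k) M≤k with saturate k M′ (ℕₚ.≤-pred (ℕₚ.<-≤-trans M′<M M≤k)) (y ∷ R)
                              (Allₚ.¬Any⇒All¬ R y∉R ∷ uniq) (Py ∷ allP) bound′
    ... | R′ , uniq′ , R⊆R′ , closed = R′ , uniq′ , R⊆R′ ∘ there , closed

-- The invariant form

module Lattice {n : ℕ} (C : Fin n → Fin n → ℤ) where

  open RootSystem C

  infixr 25 _·_
  _·_ : ℤ → V → V
  c · v = map (c *_) v

  0v : V
  0v = replicate n 0ℤ

  ext : {x y : V} → (∀ i → lookup x i ≡ lookup y i) → x ≡ y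
  ext {x} {y} eq =
    trans (sym (Vecₚ.tabulate∘lookup x)) (trans (Vecₚ.tabulate-cong eq) (Vecₚ.tabulate∘lookup y))

  lookup-⊕ : ∀ i x y → lookup (x ⊕ y) i ≡ lookup x i + lookup y i
  lookup-⊕ = Vecₚ.lookup-zipWith _+_

  lookup-neg : ∀ i x → lookup (neg x) i ≡ - lookup x i
  lookup-neg i = Vecₚ.lookup-map i (-_)

  lookup-· : ∀ i c x → lookup (c · x) i ≡ c * lookup x i
  lookup-· i c = Vecₚ.lookup-map i (c *_)

  lookup-0v : ∀ i → lookup 0v i ≡ 0ℤ
  lookup-0v i = Vecₚ.lookup-replicate i 0ℤ

  lookup-e-same : ∀ i → lookup (e i) i ≡ 1ℤ
  lookup-e-same i rewrite Vecₚ.lookup∘tabulate (λ j → if ⌊ j ≟ i ⌋ then 1ℤ else 0ℤ) i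
    with i ≟ i
  ... | yes _ = refl
  ... | no ¬p = contradiction refl ¬p

  lookup-e-other : ∀ {i j} → i ≢ j → lookup (e j) i ≡ 0ℤ
  lookup-e-other {i} {j} i≢j rewrite Vecₚ.lookup∘tabulate (λ k → if ⌊ k ≟ j ⌋ then 1ℤ else 0ℤ) i
    with i ≟ j
  ... | yes p = contradiction p i≢j
  ... | no _ = refl

  e-nonneg : ∀ j i → 0ℤ ≤ lookup (e j) i
  e-nonneg j i with i ≟ j
  ... | yes refl = subst (0ℤ ≤_) (sym (lookup-e-same i)) 0≤1
  ... | no i≢j   = subst (0ℤ ≤_) (sym (lookup-e-other i≢j)) ℤₚ.≤-refl

  neg≡-1· : ∀ x → neg x ≡ -1ℤ · x
  neg≡-1· x = ext λ i → trans (lookup-neg i x)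
    (trans (sym (ℤₚ.-1*i≡-i (lookup x i))) (sym (lookup-· i -1ℤ x)))

  neg-involutive : ∀ x → neg (neg x) ≡ x
  neg-involutive x = ext λ i → trans (lookup-neg i (neg x))
    (trans (cong -_ (lookup-neg i x)) (ℤₚ.neg-involutive (lookup x i)))

  record IsLinear (f : V → ℤ) : Set where
    field
      ⊕-homo : ∀ x y → f (x ⊕ y) ≡ f x + f y
      ·-homo : ∀ c x → f (c · x) ≡ c * f x

    0v-homo : f 0v ≡ 0ℤ
    0v-homo = begin
      f 0v          ≡⟨ cong f (ext λ i → trans (lookup-0v i) (sym (lookup-· i 0ℤ 0v))) ⟩
      f (0ℤ · 0v)   ≡⟨ ·-homo 0ℤ 0v ⟩
      0ℤ            ∎
      where open ≡-Reasoning

    neg-homo : ∀ x → f (neg x) ≡ - f x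
    neg-homo x = trans (cong f (neg≡-1· x)) (trans (·-homo -1ℤ x) (ℤₚ.-1*i≡-i (f x)))

  vsum : ∀ {m} → (Fin m → V) → V
  vsum {zero}  h = 0v
  vsum {suc m} h = h zero ⊕ vsum (h ∘ suc)

  linear-vsum : ∀ {f} → IsLinear f → ∀ {m} (h : Fin m → V) → f (vsum h) ≡ sum (f ∘ h)
  linear-vsum lin {zero}  h = IsLinear.0v-homo lin
  linear-vsum {f} lin {suc m} h = trans (IsLinear.⊕-homo lin (h zero) (vsum (h ∘ suc)))
    (cong (f (h zero) +_) (linear-vsum lin (h ∘ suc)))

  lookup-linear : ∀ i → IsLinear (λ x → lookup x i)
  lookup-linear i = record { ⊕-homo = lookup-⊕ i ; ·-homo = lookup-· i }

  coordinates : ∀ x → x ≡ vsum (λ i → lookup x i · e i)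
  coordinates x = ext λ j → sym (begin
    lookup (vsum (λ i → lookup x i · e i)) j        ≡⟨ linear-vsum (lookup-linear j) (λ i → lookup x i · e i) ⟩
    sum (λ i → lookup (lookup x i · e i) j)         ≡⟨ sum-cong-≗ (λ i → lookup-· j (lookup x i) (e i)) ⟩
    sum (λ i → lookup x i * lookup (e i) j)         ≡⟨ sum-single (λ i → lookup x i * lookup (e i) j) j (off j) ⟩
    lookup x j * lookup (e j) j                     ≡⟨ cong (lookup x j *_) (lookup-e-same j) ⟩
    lookup x j * 1ℤ                                 ≡⟨ ℤₚ.*-identityʳ (lookup x j) ⟩
    lookup x j                                      ∎)
    where
    open ≡-Reasoning
    off : ∀ j i → i ≢ j → lookup x i * lookup (e i) j ≡ 0ℤ
    off j i i≢j = trans (cong (lookup x i *_) (lookup-e-other (i≢j ∘ sym))) (ℤₚ.*-zeroʳ (lookup x i))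

  weighted : (Fin n → ℤ) → V → ℤ
  weighted c x = sum (λ i → lookup x i * c i)

  weighted-linear : ∀ c → IsLinear (weighted c)
  weighted-linear c = record
    { ⊕-homo = λ x y → trans
        (sum-cong-≗ (λ i → trans (cong (_* c i) (lookup-⊕ i x y)) (ℤₚ.*-distribʳ-+ (c i) (lookup x i) (lookup y i))))
        (∑-distrib-+ (λ i → lookup x i * c i) (λ i → lookup y i * c i))
    ; ·-homo = λ a x → trans
        (sum-cong-≗ (λ i → trans (cong (_* c i) (lookup-· i a x)) (ℤₚ.*-assoc a (lookup x i) (c i))))
        (sym (*-distribˡ-sum a (λ i → lookup x i * c i)))
    }

  expand : ∀ {f} → IsLinear f → ∀ x → f x ≡ weighted (f ∘ e) x
  expand {f} lin x = begin
    f x                                 ≡⟨ cong f (coordinates x) ⟩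
    f (vsum (λ i → lookup x i · e i))   ≡⟨ linear-vsum lin (λ i → lookup x i · e i) ⟩
    sum (λ i → f (lookup x i · e i))    ≡⟨ sum-cong-≗ (λ i → IsLinear.·-homo lin (lookup x i) (e i)) ⟩
    weighted (f ∘ e) x                  ∎
    where open ≡-Reasoning

  weighted-e : ∀ c j → weighted c (e j) ≡ c j
  weighted-e c j = begin
    weighted c (e j)       ≡⟨ sum-single (λ i → lookup (e j) i * c i) j
                                (λ i i≢j → trans (cong (_* c i) (lookup-e-other i≢j)) (ℤₚ.*-zeroˡ (c i))) ⟩
    lookup (e j) j * c j   ≡⟨ cong (_* c j) (lookup-e-same j) ⟩
    1ℤ * c j               ≡⟨ ℤₚ.*-identityˡ (c j) ⟩
    c j                    ∎
    where open ≡-Reasoning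

  linear-ext : ∀ {f g} → IsLinear f → IsLinear g → (∀ i → f (e i) ≡ g (e i)) → ∀ x → f x ≡ g x
  linear-ext linf ling eq x = trans (expand linf x)
    (trans (sum-cong-≗ (λ i → cong (lookup x i *_) (eq i))) (sym (expand ling x)))

  -- The simple reflections and the Weyl group action.

  pair≡weighted : ∀ v j → pair v j ≡ weighted (λ i → C i j) v
  pair≡weighted v j = foldr-tabulate (λ i → lookup v i * C i j)

  pair-linear : ∀ j → IsLinear (λ v → pair v j)
  pair-linear j = record
    { ⊕-homo = λ x y → trans (pair≡weighted (x ⊕ y) j) (trans (IsLinear.⊕-homo W x y)
        (sym (cong₂ _+_ (pair≡weighted x j) (pair≡weighted y j))))
    ; ·-homo = λ c x → trans (pair≡weighted (c · x) j) (trans (IsLinear.·-homo W c x)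
        (sym (cong (c *_) (pair≡weighted x j))))
    }
    where W = weighted-linear (λ i → C i j)

  pair-e : ∀ i j → pair (e i) j ≡ C i j
  pair-e i j = trans (pair≡weighted (e i) j) (weighted-e (λ i → C i j) i)

  lookup-s : ∀ j v i → lookup (s j v) i ≡ lookup v i - pair v j * lookup (e j) i
  lookup-s j v i = trans (Vecₚ.lookup-zipWith _-_ i v (map (pair v j *_) (e j)))
    (cong (_-_ (lookup v i)) (lookup-· i (pair v j) (e j)))

  lookup-s-other : ∀ {i j} → i ≢ j → ∀ v → lookup (s j v) i ≡ lookup v i
  lookup-s-other {i} {j} i≢j v = begin
    lookup (s j v) i                             ≡⟨ lookup-s j v i ⟩
    lookup v i - pair v j * lookup (e j) i       ≡⟨ cong (λ t → lookup v i - pair v j * t) (lookup-e-other i≢j) ⟩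
    lookup v i - pair v j * 0ℤ                   ≡⟨ minus-zero (lookup v i) (pair v j) ⟩
    lookup v i                                   ∎
    where
    open ≡-Reasoning
    minus-zero : ∀ x y → x - y * 0ℤ ≡ x
    minus-zero = solve-∀

  lookup-s-same : ∀ j v → lookup (s j v) j ≡ lookup v j - pair v j
  lookup-s-same j v = trans (lookup-s j v j)
    (cong (_-_ (lookup v j)) (trans (cong (pair v j *_) (lookup-e-same j)) (ℤₚ.*-identityʳ (pair v j))))

  s≡ : ∀ j v → s j v ≡ v ⊕ ((- pair v j) · e j)
  s≡ j v = ext λ i → begin
    lookup (s j v) i                               ≡⟨ lookup-s j v i ⟩
    lookup v i - pair v j * lookup (e j) i         ≡⟨ cong (lookup v i +_) (ℤₚ.neg-distribˡ-* (pair v j) (lookup (e j) i)) ⟩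
    lookup v i + (- pair v j) * lookup (e j) i     ≡⟨ cong (lookup v i +_) (lookup-· i (- pair v j) (e j)) ⟨
    lookup v i + lookup ((- pair v j) · e j) i     ≡⟨ lookup-⊕ i v ((- pair v j) · e j) ⟨
    lookup (v ⊕ ((- pair v j) · e j)) i            ∎
    where open ≡-Reasoning

  linear-s : ∀ {f} → IsLinear f → ∀ j v → f (s j v) ≡ f v - pair v j * f (e j)
  linear-s {f} lin j v = begin
    f (s j v)                           ≡⟨ cong f (s≡ j v) ⟩
    f (v ⊕ ((- pair v j) · e j))        ≡⟨ IsLinear.⊕-homo lin v _ ⟩
    f v + f ((- pair v j) · e j)        ≡⟨ cong (f v +_) (IsLinear.·-homo lin (- pair v j) (e j)) ⟩
    f v + (- pair v j) * f (e j)        ≡⟨ cong (f v +_) (sym (ℤₚ.neg-distribˡ-* (pair v j) (f (e j)))) ⟩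
    f v - pair v j * f (e j)            ∎
    where open ≡-Reasoning

  s-⊕ : ∀ j x y → s j (x ⊕ y) ≡ s j x ⊕ s j y
  s-⊕ j x y = ext λ i → begin
    lookup (s j (x ⊕ y)) i                                   ≡⟨ lookup-s j (x ⊕ y) i ⟩
    lookup (x ⊕ y) i - pair (x ⊕ y) j * lookup (e j) i       ≡⟨ cong₂ (λ a b → a - b * lookup (e j) i) (lookup-⊕ i x y)
                                                                  (IsLinear.⊕-homo (pair-linear j) x y) ⟩
    (lookup x i + lookup y i) - (pair x j + pair y j) * lookup (e j) i
      ≡⟨ rearrange (lookup x i) (lookup y i) (pair x j) (pair y j) (lookup (e j) i) ⟩
    (lookup x i - pair x j * lookup (e j) i) + (lookup y i - pair y j * lookup (e j) i)
      ≡⟨ cong₂ _+_ (lookup-s j x i) (lookup-s j y i) ⟨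
    lookup (s j x) i + lookup (s j y) i                      ≡⟨ lookup-⊕ i (s j x) (s j y) ⟨
    lookup (s j x ⊕ s j y) i                                 ∎
    where
    open ≡-Reasoning
    rearrange : ∀ a b c d t → (a + b) - (c + d) * t ≡ (a - c * t) + (b - d * t)
    rearrange = solve-∀

  s-· : ∀ j c x → s j (c · x) ≡ c · s j x
  s-· j c x = ext λ i → begin
    lookup (s j (c · x)) i                                ≡⟨ lookup-s j (c · x) i ⟩
    lookup (c · x) i - pair (c · x) j * lookup (e j) i    ≡⟨ cong₂ (λ a b → a - b * lookup (e j) i) (lookup-· i c x)
                                                               (IsLinear.·-homo (pair-linear j) c x) ⟩
    c * lookup x i - (c * pair x j) * lookup (e j) i      ≡⟨ rearrange c (lookup x i) (pair x j) (lookup (e j) i) ⟩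
    c * (lookup x i - pair x j * lookup (e j) i)          ≡⟨ cong (c *_) (lookup-s j x i) ⟨
    c * lookup (s j x) i                                  ≡⟨ lookup-· i c (s j x) ⟨
    lookup (c · s j x) i                                  ∎
    where
    open ≡-Reasoning
    rearrange : ∀ c a b t → c * a - (c * b) * t ≡ c * (a - b * t)
    rearrange = solve-∀

  act-⊕ : ∀ w x y → act w (x ⊕ y) ≡ act w x ⊕ act w y
  act-⊕ []      x y = refl
  act-⊕ (i ∷ w) x y = trans (cong (s i) (act-⊕ w x y)) (s-⊕ i (act w x) (act w y))

  act-· : ∀ w c x → act w (c · x) ≡ c · act w x
  act-· []      c x = refl
  act-· (i ∷ w) c x = trans (cong (s i) (act-· w c x)) (s-· i c (act w x))

  act-neg : ∀ w x → act w (neg x) ≡ neg (act w x)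
  act-neg w x = trans (cong (act w) (neg≡-1· x)) (trans (act-· w -1ℤ x) (sym (neg≡-1· (act w x))))

  act-++ : ∀ u w x → act (u List.++ w) x ≡ act u (act w x)
  act-++ []      w x = refl
  act-++ (i ∷ u) w x = cong (s i) (act-++ u w x)

  linear-act : ∀ {f} → IsLinear f → ∀ w → IsLinear (f ∘ act w)
  linear-act {f} lin w = record
    { ⊕-homo = λ x y → trans (cong f (act-⊕ w x y)) (IsLinear.⊕-homo lin (act w x) (act w y))
    ; ·-homo = λ c x → trans (cong f (act-· w c x)) (IsLinear.·-homo lin c (act w x))
    }

  linear-+ : ∀ {f g} → IsLinear f → IsLinear g → IsLinear (λ x → f x + g x)
  linear-+ {f} {g} F G = record
    { ⊕-homo = λ x y → trans (cong₂ _+_ (IsLinear.⊕-homo F x y) (IsLinear.⊕-homo G x y))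
                         (+-interchange (f x) (f y) (g x) (g y))
    ; ·-homo = λ c x → trans (cong₂ _+_ (IsLinear.·-homo F c x) (IsLinear.·-homo G c x))
                         (sym (ℤₚ.*-distribˡ-+ c (f x) (g x)))
    }

  linear-* : ∀ {f} → IsLinear f → ∀ a → IsLinear (λ x → f x * a)
  linear-* {f} F a = record
    { ⊕-homo = λ x y → trans (cong (_* a) (IsLinear.⊕-homo F x y)) (ℤₚ.*-distribʳ-+ a (f x) (f y))
    ; ·-homo = λ c x → trans (cong (_* a) (IsLinear.·-homo F c x)) (ℤₚ.*-assoc c (f x) a)
    }

  linear-listSum : ∀ {A : Set} {f : A → V → ℤ} → (∀ a → IsLinear (f a)) →
                   ∀ as → IsLinear (λ x → listSum (λ a → f a x) as)
  linear-listSum F []       = record { ⊕-homo = λ _ _ → refl ; ·-homo = λ c _ → sym (ℤₚ.*-zeroʳ c) }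
  linear-listSum F (a ∷ as) = linear-+ (F a) (linear-listSum F as)

  record InvariantForm : Set where
    field
      B         : V → V → ℤ
      B-sym     : ∀ x y → B x y ≡ B y x
      B-linear  : ∀ y → IsLinear (λ x → B x y)
      invariant : ∀ j x y → B (s j x) (s j y) ≡ B x y
      nonneg    : ∀ x → 0ℤ ≤ B x x
      definite  : ∀ x → B x x ≤ 0ℤ → x ≡ 0v

  -- The orbit of the coordinate functionals and its sum of squares.

  module _ (diag : ∀ i → C i i ≡ pos 2) (finite : FiniteRoots) where

    private
      L = proj₁ finite

      -- A linear functional is stored as the vector of its values on the simple roots; in this
      -- encoding the formula is precomposition with `s j`.
      _∘s_ : V → Fin n → V
      φ ∘s j = tabulate (λ i → lookup φ i - C i j * lookup φ j)

      lookup-∘s : ∀ φ j i → lookup (φ ∘s j) i ≡ lookup φ i - C i j * lookup φ j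
      lookup-∘s φ j = Vecₚ.lookup∘tabulate _

      eval : V → V → ℤ
      eval φ = weighted (lookup φ)

      eval-s : ∀ φ j x → eval φ (s j x) ≡ eval (φ ∘s j) x
      eval-s φ j = linear-ext (record { ⊕-homo = λ x y → trans (cong (eval φ) (s-⊕ j x y)) (IsLinear.⊕-homo E (s j x) (s j y))
                                      ; ·-homo = λ c x → trans (cong (eval φ) (s-· j c x)) (IsLinear.·-homo E c (s j x)) })
        (weighted-linear (lookup (φ ∘s j))) λ i → begin
          eval φ (s j (e i))                             ≡⟨ linear-s E j (e i) ⟩
          eval φ (e i) - pair (e i) j * eval φ (e j)     ≡⟨ cong₂ _-_ (weighted-e (lookup φ) i)
                                                              (cong₂ _*_ (pair-e i j) (weighted-e (lookup φ) j)) ⟩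
          lookup φ i - C i j * lookup φ j                ≡⟨ lookup-∘s φ j i ⟨
          lookup (φ ∘s j) i                              ≡⟨ weighted-e (lookup (φ ∘s j)) i ⟨
          eval (φ ∘s j) (e i)                            ∎
        where
        open ≡-Reasoning
        E = weighted-linear (lookup φ)

      ∘s-involutive : ∀ j φ → (φ ∘s j) ∘s j ≡ φ
      ∘s-involutive j φ = ext λ i → begin
        lookup ((φ ∘s j) ∘s j) i                         ≡⟨ lookup-∘s (φ ∘s j) j i ⟩
        lookup (φ ∘s j) i - C i j * lookup (φ ∘s j) j    ≡⟨ cong₂ (λ a b → a - C i j * b) (lookup-∘s φ j i) (lookup-∘s φ j j) ⟩
        (lookup φ i - C i j * lookup φ j) - C i j * (lookup φ j - C j j * lookup φ j)
          ≡⟨ cong (λ t → (lookup φ i - C i j * lookup φ j) - C i j * (lookup φ j - t * lookup φ j)) (diag j) ⟩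
        (lookup φ i - C i j * lookup φ j) - C i j * (lookup φ j - pos 2 * lookup φ j)
          ≡⟨ cancel (lookup φ i) (C i j) (lookup φ j) ⟩
        lookup φ i ∎
        where
        open ≡-Reasoning
        cancel : ∀ a c b → (a - c * b) - c * (b - pos 2 * b) ≡ a
        cancel = solve-∀

      -- The functional is the coordinate at `r` composed with `w`. Its entries are coefficients of
      -- roots, hence taken from a finite set of integers, so only finitely many such functionals
      -- occur.
      InOrbit : V → Set
      InOrbit φ = ∃ λ w → ∃ λ r → ∀ i → lookup φ i ≡ lookup (act w (e i)) r

      ∘s-orbit : ∀ j {φ} → InOrbit φ → InOrbit (φ ∘s j)
      ∘s-orbit j {φ} (w , r , eq) = w List.++ j ∷ [] , r , λ i → begin
        lookup (φ ∘s j) i                            ≡⟨ lookup-∘s φ j i ⟩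
        lookup φ i - C i j * lookup φ j              ≡⟨ cong₂ (λ a b → a - C i j * b) (eq i) (eq j) ⟩
        lookup (act w (e i)) r - C i j * lookup (act w (e j)) r
          ≡⟨ cong (λ t → lookup (act w (e i)) r - t * lookup (act w (e j)) r) (pair-e i j) ⟨
        lookup (act w (e i)) r - pair (e i) j * lookup (act w (e j)) r
          ≡⟨ linear-s (linear-act (lookup-linear r) w) j (e i) ⟨
        lookup (act w (s j (e i))) r                 ≡⟨ cong (λ v → lookup v r) (act-++ w (j ∷ []) (e i)) ⟨
        lookup (act (w List.++ j ∷ []) (e i)) r      ∎
        where open ≡-Reasoning

      entries : List ℤ
      entries = List.concat (List.map (λ v → List.tabulate (lookup v)) L)

      candidates : List V
      candidates = vectorsFrom entries n

      orbit⊆candidates : ∀ {φ} → InOrbit φ → φ ∈ candidates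
      orbit⊆candidates {φ} (w , r , eq) = ∈-vectorsFrom φ λ i →
        subst (_∈ entries) (sym (eq i))
          (∈-concat⁺′ (∈-tabulate⁺ r) (∈-map⁺ (λ v → List.tabulate (lookup v)) (proj₂ finite (act w (e i)) (w , i , refl))))

      e-injective : ∀ {i j} → e i ≡ e j → i ≡ j
      e-injective {i} {j} eq with i ≟ j
      ... | yes i≡j = i≡j
      ... | no i≢j with trans (sym (lookup-e-same i)) (trans (cong (λ v → lookup v i) eq) (lookup-e-other i≢j))
      ...   | ()

      -- The identity matrix is symmetric, so `e r`, read as a functional, is the coordinate at `r`;
      -- the word is empty.
      e-orbit : ∀ r → InOrbit (e r)
      e-orbit r = [] , r , λ i → lookup-e-sym i
        where
        lookup-e-sym : ∀ i → lookup (e r) i ≡ lookup (e i) r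
        lookup-e-sym i with i ≟ r
        ... | yes refl = refl
        ... | no i≢r   = trans (lookup-e-other i≢r) (sym (lookup-e-other (i≢r ∘ sym)))

      -- The index list of the sum of squares. Absence of repetitions is part of the data because
      -- invariance rests on each reflection permuting the list.
      orbit : ∃ λ R → Unique R × (∀ {φ} → φ ∈ List.tabulate e → φ ∈ R) × (∀ j {φ} → φ ∈ R → (φ ∘s j) ∈ R)
      orbit = saturate (List.length candidates) candidates ℕₚ.≤-refl (List.tabulate e)
                (Uniqueₚ.tabulate⁺ e-injective) (Allₚ.tabulate⁺ e-orbit) (inj₂ ∘ orbit⊆candidates)
        where open Closure (Vecₚ.≡-dec ℤₚ._≟_) (λ j φ → φ ∘s j) InOrbit ∘s-orbit

      R = proj₁ orbit

      form : V → V → ℤ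
      form x y = listSum (λ φ → eval φ x * eval φ y) R

      -- The coordinate functional at `r` belongs to `R`, so its square is one of the nonnegative
      -- terms. This yields definiteness.
      coordinate≤form : ∀ x r → lookup x r * lookup x r ≤ form x x
      coordinate≤form x r = subst (λ t → t * t ≤ form x x) (eval-e r)
        (term≤listSum (λ φ → eval φ x * eval φ x) (λ φ → square-nonneg (eval φ x)) (proj₁ (proj₂ (proj₂ orbit)) (∈-tabulate⁺ r)))
        where
        eval-e : ∀ r → eval (e r) x ≡ lookup x r
        eval-e r = linear-ext (weighted-linear (lookup (e r))) (lookup-linear r)
          (λ i → trans (weighted-e (lookup (e r)) i) (proj₂ (proj₂ (e-orbit r)) i)) x

    invariantForm : InvariantForm
    invariantForm = record
      { B         = form
      ; B-sym     = λ x y → listSum-cong (λ φ → ℤₚ.*-comm (eval φ x) (eval φ y)) R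
      ; B-linear  = λ y → linear-listSum (λ φ → linear-* (weighted-linear (lookup φ)) (eval φ y)) R
      ; invariant = λ j x y → begin
          form (s j x) (s j y)
            ≡⟨ listSum-cong (λ φ → cong₂ _*_ (eval-s φ j x) (eval-s φ j y)) R ⟩
          listSum (λ φ → eval (φ ∘s j) x * eval (φ ∘s j) y) R
            ≡⟨ listSum-map (λ φ → eval φ x * eval φ y) (_∘s j) R ⟨
          listSum (λ φ → eval φ x * eval φ y) (List.map (_∘s j) R)
            ≡⟨ listSum-↭ (λ φ → eval φ x * eval φ y)
                 (involution-permutes (_∘s j) (∘s-involutive j) (proj₁ (proj₂ orbit)) (proj₂ (proj₂ (proj₂ orbit)) j)) ⟩
          form x y ∎
      ; nonneg    = λ x → listSum-nonneg (λ φ → eval φ x * eval φ x) (λ φ → square-nonneg (eval φ x)) R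
      ; definite  = λ x B≤0 → ext λ r →
          trans (square≤0⇒≡0 (lookup x r) (ℤₚ.≤-trans (coordinate≤form x r) B≤0)) (sym (lookup-0v r))
      }
      where open ≡-Reasoning

-- Signs of roots

module Roots {n : ℕ} (C : Fin n → Fin n → ℤ) (gcm : IsGCM C) (F : Lattice.InvariantForm C) where

  open RootSystem C
  open Lattice C
  open InvariantForm F
  open IsGCM gcm
  open IsLinear

  NonNeg NonPos : V → Set
  NonNeg v = ∀ i → 0ℤ ≤ lookup v i
  NonPos v = ∀ i → lookup v i ≤ 0ℤ

  neg-NonPos : ∀ {v} → NonPos v → NonNeg (neg v)
  neg-NonPos {v} v≤0 i = subst (0ℤ ≤_) (sym (lookup-neg i v)) (neg-nonneg (v≤0 i))

  neg-NonNeg : ∀ {v} → NonNeg v → NonPos (neg v)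
  neg-NonNeg {v} 0≤v i = subst (_≤ 0ℤ) (sym (lookup-neg i v)) (neg-nonpos (0≤v i))

  neg-NonNeg⁻ : ∀ {v} → NonNeg (neg v) → NonPos v
  neg-NonNeg⁻ {v} 0≤-v i = 0≤-neg⁻ (subst (0ℤ ≤_) (lookup-neg i v) (0≤-v i))

  B-linearʳ : ∀ x → IsLinear (B x)
  B-linearʳ x = record
    { ⊕-homo = λ y z → trans (B-sym x (y ⊕ z)) (trans (⊕-homo (B-linear x) y z) (cong₂ _+_ (B-sym y x) (B-sym z x)))
    ; ·-homo = λ c y → trans (B-sym x (c · y)) (trans (·-homo (B-linear x) c y) (cong (c *_) (B-sym y x)))
    }

  d : Fin n → ℤ
  d j = B (e j) (e j)

  1≤d : ∀ j → 1ℤ ≤ d j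
  1≤d j with ≤0⊎1≤ (d j)
  ... | inj₂ p = p
  ... | inj₁ p with trans (sym (lookup-e-same j)) (trans (cong (λ v → lookup v j) (definite (e j) p)) (lookup-0v j))
  ...   | ()

  s-e : ∀ j → s j (e j) ≡ neg (e j)
  s-e j = ext λ i → begin
    lookup (s j (e j)) i                              ≡⟨ lookup-s j (e j) i ⟩
    lookup (e j) i - pair (e j) j * lookup (e j) i    ≡⟨ cong (λ t → lookup (e j) i - t * lookup (e j) i) (trans (pair-e j j) (diag j)) ⟩
    lookup (e j) i - pos 2 * lookup (e j) i           ≡⟨ minus-double (lookup (e j) i) ⟩
    - lookup (e j) i                                  ≡⟨ lookup-neg i (e j) ⟨
    lookup (neg (e j)) i                              ∎
    where
    open ≡-Reasoning
    minus-double : ∀ x → x - pos 2 * x ≡ - x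
    minus-double = solve-∀

  -- The reflection `s j` preserves `B` and negates `e j`, so `B x (e j)` equals
  -- `- B (s j x) (e j)`; expanding `s j x` gives the relation.
  pair-B : ∀ x j → pos 2 * B x (e j) ≡ pair x j * d j
  pair-B x j = double≡ (B x (e j)) (pair x j * d j) (begin
    B x (e j)                             ≡⟨ invariant j x (e j) ⟨
    B (s j x) (s j (e j))                 ≡⟨ cong (B (s j x)) (s-e j) ⟩
    B (s j x) (neg (e j))                 ≡⟨ neg-homo (B-linearʳ (s j x)) (e j) ⟩
    - B (s j x) (e j)                     ≡⟨ cong -_ (linear-s (B-linear (e j)) j x) ⟩
    - (B x (e j) - pair x j * d j)        ∎)
    where
    open ≡-Reasoning
    rearrange : ∀ a b → a + (- (a - b)) ≡ b
    rearrange = solve-∀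
    twice : ∀ a → pos 2 * a ≡ a + a
    twice = solve-∀
    double≡ : ∀ a b → a ≡ - (a - b) → pos 2 * a ≡ b
    double≡ a b eq = trans (twice a) (trans (cong (a +_) eq) (rearrange a b))

  s-involutive : ∀ j x → s j (s j x) ≡ x
  s-involutive j x = ext λ i → begin
    lookup (s j (s j x)) i                                     ≡⟨ linear-s (linear-act (lookup-linear i) (j ∷ [])) j x ⟩
    lookup (s j x) i - pair x j * lookup (s j (e j)) i         ≡⟨ cong₂ (λ a b → a - pair x j * b) (lookup-s j x i)
                                                                    (trans (cong (λ v → lookup v i) (s-e j)) (lookup-neg i (e j))) ⟩
    (lookup x i - pair x j * lookup (e j) i) - pair x j * (- lookup (e j) i)
      ≡⟨ cancel (lookup x i) (pair x j) (lookup (e j) i) ⟩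
    lookup x i                                                 ∎
    where
    open ≡-Reasoning
    cancel : ∀ a p t → (a - p * t) - p * (- t) ≡ a
    cancel = solve-∀

  act-invˡ : ∀ w x → act (inv w) (act w x) ≡ x
  act-invˡ []      x = refl
  act-invˡ (j ∷ w) x = begin
    act (inv (j ∷ w)) (s j (act w x))            ≡⟨ cong (λ u → act u (s j (act w x))) (Listₚ.unfold-reverse j w) ⟩
    act (inv w List.++ j ∷ []) (s j (act w x))   ≡⟨ act-++ (inv w) (j ∷ []) _ ⟩
    act (inv w) (s j (s j (act w x)))            ≡⟨ cong (act (inv w)) (s-involutive j (act w x)) ⟩
    act (inv w) (act w x)                        ≡⟨ act-invˡ w x ⟩
    x                                            ∎
    where open ≡-Reasoning

  act-invʳ : ∀ w x → act w (act (inv w) x) ≡ x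
  act-invʳ w x = subst (λ u → act u (act (inv w) x) ≡ x) (Listₚ.reverse-involutive w) (act-invˡ (inv w) x)

  B-act : ∀ w x y → B (act w x) (act w y) ≡ B x y
  B-act []      x y = refl
  B-act (j ∷ w) x y = trans (invariant j (act w x) (act w y)) (B-act w x y)

  root-e : ∀ i → IsRoot (e i)
  root-e i = [] , i , refl

  posRoot-e : ∀ i → PosRoot (e i)
  posRoot-e i = root-e i , e-nonneg i

  root-act : ∀ u {v} → IsRoot v → IsRoot (act u v)
  root-act u (w , i , refl) = u List.++ w , i , act-++ u w (e i)

  root-neg : ∀ {v} → IsRoot v → IsRoot (neg v)
  root-neg (w , i , refl) = w List.++ i ∷ [] , i ,
    trans (act-++ w (i ∷ []) (e i)) (trans (cong (act w) (s-e i)) (act-neg w (e i)))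

  1≤B-root : ∀ {v} → IsRoot v → 1ℤ ≤ B v v
  1≤B-root (w , i , refl) = subst (1ℤ ≤_) (sym (B-act w (e i) (e i))) (1≤d i)

  root-sign-unique : ∀ {v} → IsRoot v → NonNeg v → NonPos v → ⊥
  root-sign-unique {v} rv 0≤v v≤0 = 1≰0 (subst (1ℤ ≤_) Bvv≡0 (1≤B-root rv))
    where
    v≡0 : v ≡ 0v
    v≡0 = ext λ i → trans (ℤₚ.≤-antisym (v≤0 i) (0≤v i)) (sym (lookup-0v i))
    Bvv≡0 : B v v ≡ 0ℤ
    Bvv≡0 = trans (cong (λ u → B u v) v≡0) (0v-homo (B-linear v))

  -- d j times the coefficient at e j is divisible by d k for every vector in the W-orbit of e k;
  -- on the lattice cut out by this coefficientwise condition the values B x x are multiples of d k.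
  InLattice : Fin n → V → Set
  InLattice k x = ∀ i → d k ∣ lookup x i * d i

  e-InLattice : ∀ k → InLattice k (e k)
  e-InLattice k i with i ≟ k
  ... | yes refl = ∣n⇒∣m*n (lookup (e k) k) ∣-refl
  ... | no i≢k   = subst (d k ∣_) (sym (trans (cong (_* d i) (lookup-e-other i≢k)) (ℤₚ.*-zeroˡ (d i)))) (divides 0ℤ refl)

  -- Only the coefficient at `j` changes, by `pair x j`. Multiplied by `d j`, this change is twice
  -- `B x (e j)`; expanding over the simple roots and using the symmetry of `B` writes it as a sum
  -- of the integers `pair (e j) i` times `lookup x i * d i`.
  s-InLattice : ∀ k j x → InLattice k x → InLattice k (s j x)
  s-InLattice k j x x∈L i with i ≟ j
  ... | no i≢j   = subst (λ t → d k ∣ t * d i) (sym (lookup-s-other i≢j x)) (x∈L i)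
  ... | yes refl = subst (d k ∣_) (sym eq) (∣m∣n⇒∣m-n (x∈L j) (∣-sum (d k) _ λ i → subst (d k ∣_) (term i) (∣n⇒∣m*n (pair (e j) i) (x∈L i))))
    where
    open ≡-Reasoning
    2B : V → ℤ
    2B y = pos 2 * B y (e j)
    2B-linear : IsLinear 2B
    2B-linear = record
      { ⊕-homo = λ y z → trans (cong (pos 2 *_) (⊕-homo (B-linear (e j)) y z)) (ℤₚ.*-distribˡ-+ (pos 2) (B y (e j)) (B z (e j)))
      ; ·-homo = λ c y → trans (cong (pos 2 *_) (·-homo (B-linear (e j)) c y)) (x*yz≡y*xz (pos 2) c (B y (e j)))
      }
    term : ∀ i → pair (e j) i * (lookup x i * d i) ≡ lookup x i * 2B (e i)
    term i = begin
      pair (e j) i * (lookup x i * d i)     ≡⟨ x*yz≡y*xz (pair (e j) i) (lookup x i) (d i) ⟩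
      lookup x i * (pair (e j) i * d i)     ≡⟨ cong (lookup x i *_) (pair-B (e j) i) ⟨
      lookup x i * (pos 2 * B (e j) (e i))  ≡⟨ cong (λ t → lookup x i * (pos 2 * t)) (B-sym (e j) (e i)) ⟩
      lookup x i * 2B (e i)                 ∎
    eq : lookup (s j x) j * d j ≡ lookup x j * d j - sum (λ i → lookup x i * 2B (e i))
    eq = begin
      lookup (s j x) j * d j                 ≡⟨ cong (_* d j) (lookup-s-same j x) ⟩
      (lookup x j - pair x j) * d j          ≡⟨ distrib (lookup x j) (pair x j) (d j) ⟩
      lookup x j * d j - pair x j * d j      ≡⟨ cong (_-_ (lookup x j * d j)) (trans (sym (pair-B x j)) (expand 2B-linear x)) ⟩
      lookup x j * d j - weighted (2B ∘ e) x ∎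
      where
      distrib : ∀ a b c → (a - b) * c ≡ a * c - b * c
      distrib = solve-∀

  act-InLattice : ∀ k w → InLattice k (act w (e k))
  act-InLattice k []      = e-InLattice k
  act-InLattice k (j ∷ w) = s-InLattice k j (act w (e k)) (act-InLattice k w)

  B-⊕-square : ∀ x y → B (x ⊕ y) (x ⊕ y) ≡ B x x + pos 2 * B x y + B y y
  B-⊕-square x y = begin
    B (x ⊕ y) (x ⊕ y)                        ≡⟨ ⊕-homo (B-linear (x ⊕ y)) x y ⟩
    B x (x ⊕ y) + B y (x ⊕ y)                ≡⟨ cong₂ _+_ (⊕-homo (B-linearʳ x) x y) (⊕-homo (B-linearʳ y) x y) ⟩
    (B x x + B x y) + (B y x + B y y)        ≡⟨ cong (λ t → (B x x + B x y) + (t + B y y)) (B-sym y x) ⟩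
    (B x x + B x y) + (B x y + B y y)        ≡⟨ collect (B x x) (B x y) (B y y) ⟩
    B x x + pos 2 * B x y + B y y            ∎
    where
    open ≡-Reasoning
    collect : ∀ a b c → (a + b) + (b + c) ≡ a + pos 2 * b + c
    collect = solve-∀

  B-neg-neg : ∀ x → B (neg x) (neg x) ≡ B x x
  B-neg-neg x = trans (neg-homo (B-linear (neg x)) x)
    (trans (cong -_ (neg-homo (B-linearʳ x) x)) (ℤₚ.neg-involutive (B x x)))

  -- Splitting off one term `c · e j` from a sum with remainder `r` changes the norm by
  -- `(c * d j) * (c + pair r j)`, a multiple of `d k` by the lattice condition.
  ∣B : ∀ k {x} → InLattice k x → d k ∣ B x x
  ∣B k {x} x∈L = subst (λ v → d k ∣ B v v) (sym (coordinates x)) (partial id)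
    where
    open ≡-Reasoning
    collect : ∀ c p b t → c * (c * b) + c * (p * b) + t ≡ (c * b) * (c + p) + t
    collect = solve-∀
    -- The indices run through an arbitrary `h` so that the induction can drop one of them; `id`
    -- gives all of `x`.
    partial : ∀ {m} (h : Fin m → Fin n) → let r = vsum (λ a → lookup x (h a) · e (h a)) in d k ∣ B r r
    partial {zero}  h = divides 0ℤ (0v-homo (B-linear 0v))
    partial {suc m} h = subst (d k ∣_) (sym eq) (∣m∣n⇒∣m+n (∣m⇒∣m*n (c + pair r j) (x∈L j)) (partial (h ∘ suc)))
      where
      j = h zero
      c = lookup x j
      r = vsum (λ a → lookup x (h (suc a)) · e (h (suc a)))
      eq : B (c · e j ⊕ r) (c · e j ⊕ r) ≡ (c * d j) * (c + pair r j) + B r r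
      eq = begin
        B (c · e j ⊕ r) (c · e j ⊕ r)
          ≡⟨ B-⊕-square (c · e j) r ⟩
        B (c · e j) (c · e j) + pos 2 * B (c · e j) r + B r r
          ≡⟨ cong₂ (λ a b → a + b + B r r)
               (trans (·-homo (B-linear (c · e j)) c (e j)) (cong (c *_) (·-homo (B-linearʳ (e j)) c (e j))))
               (begin
                  pos 2 * B (c · e j) r      ≡⟨ cong (pos 2 *_) (·-homo (B-linear r) c (e j)) ⟩
                  pos 2 * (c * B (e j) r)    ≡⟨ x*yz≡y*xz (pos 2) c (B (e j) r) ⟩
                  c * (pos 2 * B (e j) r)    ≡⟨ cong (λ t → c * (pos 2 * t)) (B-sym (e j) r) ⟩
                  c * (pos 2 * B r (e j))    ≡⟨ cong (c *_) (pair-B r j) ⟩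
                  c * (pair r j * d j)       ∎) ⟩
        c * (c * d j) + c * (pair r j * d j) + B r r
          ≡⟨ collect c (pair r j) (d j) (B r r) ⟩
        (c * d j) * (c + pair r j) + B r r ∎

  -- Positive and negative parts of a vector.

  B-e-nonpos : ∀ {i j} → i ≢ j → B (e i) (e j) ≤ 0ℤ
  B-e-nonpos {i} {j} i≢j = double-nonpos (subst (_≤ 0ℤ) (sym (pair-B (e i) j))
    (nonpos*nonneg (subst (_≤ 0ℤ) (sym (pair-e i j)) (offdiag i j i≢j)) (1≤⇒0≤ (1≤d j))))

  -- In the expansion over pairs of simple roots the diagonal terms vanish because the supports are
  -- disjoint, and the others contain some `B (e i) (e j) ≤ 0`.
  B-disjoint-nonpos : ∀ {x y} → NonNeg x → NonNeg y → (∀ i → lookup x i ≡ 0ℤ ⊎ lookup y i ≡ 0ℤ) → B x y ≤ 0ℤ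
  B-disjoint-nonpos {x} {y} 0≤x 0≤y disjoint =
    subst (_≤ 0ℤ) (sym (expand (B-linear y) x)) (sum-nonpos _ term)
    where
    term : ∀ i → lookup x i * B (e i) y ≤ 0ℤ
    term i with disjoint i
    ... | inj₁ xᵢ≡0 = ℤₚ.≤-reflexive (trans (cong (_* B (e i) y) xᵢ≡0) (ℤₚ.*-zeroˡ (B (e i) y)))
    ... | inj₂ yᵢ≡0 = nonneg*nonpos (0≤x i) (subst (_≤ 0ℤ) (sym (expand (B-linearʳ (e i)) y)) (sum-nonpos _ inner))
      where
      inner : ∀ j → lookup y j * B (e i) (e j) ≤ 0ℤ
      inner j with i ≟ j
      ... | yes refl = ℤₚ.≤-reflexive (trans (cong (_* d i) yᵢ≡0) (ℤₚ.*-zeroˡ (d i)))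
      ... | no i≢j   = nonneg*nonpos (0≤y j) (B-e-nonpos i≢j)

  posPart : V → V
  posPart v = tabulate (λ i → lookup v i ⁺)

  lookup-posPart : ∀ v i → lookup (posPart v) i ≡ lookup v i ⁺
  lookup-posPart v i = Vecₚ.lookup∘tabulate (λ i → lookup v i ⁺) i

  lookup-negPart : ∀ v i → lookup (posPart (neg v)) i ≡ (- lookup v i) ⁺
  lookup-negPart v i = trans (lookup-posPart (neg v) i) (cong _⁺ (lookup-neg i v))

  posPart-nonneg : ∀ v → NonNeg (posPart v)
  posPart-nonneg v i = subst (0ℤ ≤_) (sym (lookup-posPart v i)) (⁺-nonneg (lookup v i))

  -- Each coefficient is kept or replaced by 0, which a coefficientwise condition survives. This is
  -- the reason for describing the lattice in that form.
  posPart-InLattice : ∀ k v → InLattice k v → InLattice k (posPart v)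
  posPart-InLattice k v v∈L i = subst (λ t → d k ∣ t * d i) (sym (lookup-posPart v i))
    ([ (λ eq → subst (λ t → d k ∣ t * d i) (sym eq) (v∈L i))
     , (λ eq → subst (λ t → d k ∣ t * d i) (sym eq) (subst (d k ∣_) (sym (ℤₚ.*-zeroˡ (d i))) (divides 0ℤ refl)))
     ]′ (⁺-cases (lookup v i)))

  neg-InLattice : ∀ k v → InLattice k v → InLattice k (neg v)
  neg-InLattice k v v∈L i = subst (λ t → d k ∣ t * d i) (sym (lookup-neg i v))
    (subst (d k ∣_) (ℤₚ.neg-distribˡ-* (lookup v i) (d i)) (∣m⇒∣-m (v∈L i)))

  posPart-difference : ∀ v → v ≡ posPart v ⊕ neg (posPart (neg v))
  posPart-difference v = ext λ i → trans (⁺-difference (lookup v i))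
    (sym (trans (lookup-⊕ i (posPart v) (neg (posPart (neg v))))
      (cong₂ _+_ (lookup-posPart v i) (trans (lookup-neg i (posPart (neg v))) (cong -_ (lookup-negPart v i))))))

  posPart-null : ∀ v → B (posPart v) (posPart v) ≤ 0ℤ → NonPos v
  posPart-null v B≤0 i = ⁺≡0⇒nonpos (lookup v i)
    (trans (sym (lookup-posPart v i)) (trans (cong (λ u → lookup u i) (definite (posPart v) B≤0)) (lookup-0v i)))

  -- For p and m the positive and negative parts of v, the norm B v v ≥ B p p + B m m would be at least 2 B v v.
  no-mixed-root : ∀ {v} → IsRoot v → 1ℤ ≤ B (posPart v) (posPart v) → 1ℤ ≤ B (posPart (neg v)) (posPart (neg v)) → ⊥
  no-mixed-root {v} (w , k , v≡) 1≤Bpp 1≤Bmm = 0≰-1 absurd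
    where
    open ≡-Reasoning
    p m : V
    p = posPart v
    m = posPart (neg v)
    v∈L : InLattice k v
    v∈L = subst (InLattice k) v≡ (act-InLattice k w)
    Bpm≤0 : B p m ≤ 0ℤ
    Bpm≤0 = B-disjoint-nonpos {p} {m} (posPart-nonneg v) (posPart-nonneg (neg v))
      (λ i → [ inj₁ ∘ trans (lookup-posPart v i) , inj₂ ∘ trans (lookup-negPart v i) ]′ (⁺-disjoint (lookup v i)))
    norm : d k ≡ B p p + pos 2 * (- B p m) + B m m
    norm = begin
      d k                                                ≡⟨ B-act w (e k) (e k) ⟨
      B (act w (e k)) (act w (e k))                      ≡⟨ cong (λ u → B u u) (trans v≡ (posPart-difference v)) ⟩
      B (p ⊕ neg m) (p ⊕ neg m)                          ≡⟨ B-⊕-square p (neg m) ⟩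
      B p p + pos 2 * B p (neg m) + B (neg m) (neg m)    ≡⟨ cong₂ (λ a b → B p p + pos 2 * a + b) (neg-homo (B-linearʳ p) m) (B-neg-neg m) ⟩
      B p p + pos 2 * (- B p m) + B m m                  ∎
    -- The nonnegative terms collected in `absurd` add up to -1 once the norm of `v` is expanded.
    cancel : ∀ a b c → (a - (a + pos 2 * c + b)) + (b - (a + pos 2 * c + b)) + (c + c) + ((a + pos 2 * c + b) - 1ℤ) ≡ -1ℤ
    cancel = solve-∀
    absurd : 0ℤ ≤ -1ℤ
    absurd = subst (0ℤ ≤_) (trans (cong (λ t → (B p p - t) + (B m m - t) + (- B p m + - B p m) + (t - 1ℤ)) norm)
                                    (cancel (B p p) (B m m) (- B p m)))
      (+-nonneg (+-nonneg (+-nonneg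
          -- Both parts satisfy the lattice condition, so their norms are positive multiples of
          -- `d k` and hence at least `d k`.
          (ℤₚ.i≤j⇒0≤j-i (∣⇒≤ (1≤d k) 1≤Bpp (∣B k (posPart-InLattice k v v∈L))))
          (ℤₚ.i≤j⇒0≤j-i (∣⇒≤ (1≤d k) 1≤Bmm (∣B k (posPart-InLattice k (neg v) (neg-InLattice k v v∈L))))))
          (+-nonneg (neg-nonneg Bpm≤0) (neg-nonneg Bpm≤0)))
        (ℤₚ.i≤j⇒0≤j-i (1≤d k)))

  abstract
    -- A part of norm at most 0 vanishes by definiteness, which fixes the sign; two parts of
    -- positive norm are excluded by `no-mixed-root`.
    root-sign : ∀ {v} → IsRoot v → NonNeg v ⊎ NonPos v
    root-sign {v} rv with ≤0⊎1≤ (B (posPart v) (posPart v)) | ≤0⊎1≤ (B (posPart (neg v)) (posPart (neg v)))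
    ... | inj₁ Bpp≤0 | _          = inj₂ (posPart-null v Bpp≤0)
    ... | inj₂ _     | inj₁ Bmm≤0 = inj₁ (subst NonNeg (neg-involutive v) (neg-NonPos {neg v} (posPart-null (neg v) Bmm≤0)))
    ... | inj₂ 1≤Bpp | inj₂ 1≤Bmm = ⊥-elim (no-mixed-root rv 1≤Bpp 1≤Bmm)

-- Sums and differences of roots

module Chains {n : ℕ} (C : Fin n → Fin n → ℤ) (gcm : IsGCM C) (F : Lattice.InvariantForm C) where

  open RootSystem C
  open Lattice C
  open InvariantForm F
  open Roots C gcm F
  open IsLinear

  -- Such a root is `c · e j`. Undoing `w` turns it into the simple root `e k`, so `c` divides the
  -- coefficient 1; being nonnegative, it is 1.
  axis-root : ∀ {v} j → IsRoot v → NonNeg v → (∀ i → i ≢ j → lookup v i ≡ 0ℤ) → v ≡ e j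
  axis-root {v} j (w , k , v≡) 0≤v off = trans v≡c·e (trans (cong (_· e j) c≡1) 1·e)
    where
    open ≡-Reasoning
    c = lookup v j
    v≡c·e : v ≡ c · e j
    v≡c·e = ext coordinate
      where
      coordinate : ∀ i → lookup v i ≡ lookup (c · e j) i
      coordinate i with i ≟ j
      ... | yes refl = sym (trans (lookup-· i c (e i)) (trans (cong (c *_) (lookup-e-same i)) (ℤₚ.*-identityʳ c)))
      ... | no i≢j   = trans (off i i≢j)
                         (sym (trans (lookup-· i c (e j)) (trans (cong (c *_) (lookup-e-other i≢j)) (ℤₚ.*-zeroʳ c))))
    c≡1 : c ≡ 1ℤ
    c≡1 = nonneg-unit (lookup (act (inv w) (e j)) k) (0≤v j) (begin
      c * lookup (act (inv w) (e j)) k       ≡⟨ lookup-· k c (act (inv w) (e j)) ⟨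
      lookup (c · act (inv w) (e j)) k       ≡⟨ cong (λ u → lookup u k) (act-· (inv w) c (e j)) ⟨
      lookup (act (inv w) (c · e j)) k       ≡⟨ cong (λ u → lookup (act (inv w) u) k) (trans v≡ v≡c·e) ⟨
      lookup (act (inv w) (act w (e k))) k   ≡⟨ cong (λ u → lookup u k) (act-invˡ w (e k)) ⟩
      lookup (e k) k                         ≡⟨ lookup-e-same k ⟩
      1ℤ                                     ∎)
    1·e : 1ℤ · e j ≡ e j
    1·e = ext λ i → trans (lookup-· i 1ℤ (e j)) (ℤₚ.*-identityˡ (lookup (e j) i))

  -- With `y` written as `act w (e j)`, the reflection in `y` is `s j` conjugated by `w`, and `m` is
  -- the Cartan integer of `x` against `y`.
  reflect : ∀ {x y} → IsRoot x → IsRoot y →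
            ∃ λ m → pos 2 * B x y ≡ m * B y y × IsRoot (x ⊕ ((- m) · y))
  reflect {x} rx (w , j , refl) = m , 2B≡ , subst IsRoot reflected (root-act w (root-act (j ∷ inv w) rx))
    where
    open ≡-Reasoning
    x′ = act (inv w) x
    m = pair x′ j
    2B≡ : pos 2 * B x (act w (e j)) ≡ m * B (act w (e j)) (act w (e j))
    2B≡ = begin
      pos 2 * B x (act w (e j))            ≡⟨ cong (λ u → pos 2 * B u (act w (e j))) (act-invʳ w x) ⟨
      pos 2 * B (act w x′) (act w (e j))   ≡⟨ cong (pos 2 *_) (B-act w x′ (e j)) ⟩
      pos 2 * B x′ (e j)                   ≡⟨ pair-B x′ j ⟩
      m * d j                              ≡⟨ cong (m *_) (B-act w (e j) (e j)) ⟨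
      m * B (act w (e j)) (act w (e j))    ∎
    reflected : act w (s j x′) ≡ x ⊕ ((- m) · act w (e j))
    reflected = begin
      act w (s j x′)                       ≡⟨ cong (act w) (s≡ j x′) ⟩
      act w (x′ ⊕ ((- m) · e j))           ≡⟨ act-⊕ w x′ ((- m) · e j) ⟩
      act w x′ ⊕ act w ((- m) · e j)       ≡⟨ cong₂ _⊕_ (act-invʳ w x) (act-· w (- m) (e j)) ⟩
      x ⊕ ((- m) · act w (e j))            ∎

  private
    multiplier-positive : ∀ {b m q} → 1ℤ ≤ b → 1ℤ ≤ q → pos 2 * b ≡ m * q → 1ℤ ≤ m
    multiplier-positive {b} {m} {q} 1≤b 1≤q eq with ≤0⊎1≤ m
    ... | inj₂ 1≤m = 1≤m
    ... | inj₁ m≤0 = contradiction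
          (ℤₚ.≤-trans 1≤b (double-nonpos (subst (_≤ 0ℤ) (sym eq) (nonpos*nonneg m≤0 (1≤⇒0≤ 1≤q))))) 1≰0

    double≤ : ∀ {m q} → pos 2 ≤ m → 0ℤ ≤ q → pos 2 * q ≤ m * q
    double≤ {m} {q} 2≤m 0≤q = ℤₚ.*-monoʳ-≤-nonNeg q {{nonNegative 0≤q}} 2≤m

  abstract
    -- Both Cartan integers of `x` and `y` are positive. If one is 1, a reflection yields the
    -- difference up to sign. If both are at least 2, then `B x x` and `B y y` are at most `B x y`,
    -- so `x ⊕ neg y` has norm at most 0 and is zero.
    difference : ∀ {x y} → IsRoot x → IsRoot y → 1ℤ ≤ B x y → x ≡ y ⊎ IsRoot (x ⊕ neg y)
    difference {x} {y} rx ry 1≤Bxy with reflect rx ry | reflect ry rx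
    ... | m , eq , r | m′ , eq′ , r′
      with 1≤⇒≡1⊎2≤ (multiplier-positive {B x y} {m} {B y y} 1≤Bxy (1≤B-root ry) eq)
         | 1≤⇒≡1⊎2≤ (multiplier-positive {B y x} {m′} {B x x} (subst (1ℤ ≤_) (B-sym x y) 1≤Bxy) (1≤B-root rx) eq′)
    ... | inj₁ refl | _         = inj₂ (subst (λ v → IsRoot (x ⊕ v)) (sym (neg≡-1· y)) r)
    ... | inj₂ _    | inj₁ refl = inj₂ (subst IsRoot flip (root-neg r′))
      where
      open ≡-Reasoning
      flip : neg (y ⊕ (-1ℤ · x)) ≡ x ⊕ neg y
      flip = ext λ i → begin
        lookup (neg (y ⊕ (-1ℤ · x))) i          ≡⟨ lookup-neg i (y ⊕ (-1ℤ · x)) ⟩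
        - lookup (y ⊕ (-1ℤ · x)) i              ≡⟨ cong -_ (lookup-⊕ i y (-1ℤ · x)) ⟩
        - (lookup y i + lookup (-1ℤ · x) i)     ≡⟨ cong (λ t → - (lookup y i + t)) (lookup-· i -1ℤ x) ⟩
        - (lookup y i + -1ℤ * lookup x i)       ≡⟨ rearrange (lookup y i) (lookup x i) ⟩
        lookup x i + - lookup y i               ≡⟨ cong (lookup x i +_) (lookup-neg i y) ⟨
        lookup x i + lookup (neg y) i           ≡⟨ lookup-⊕ i x (neg y) ⟨
        lookup (x ⊕ neg y) i                    ∎
        where
        rearrange : ∀ a b → - (a + -1ℤ * b) ≡ b + - a
        rearrange = solve-∀
    ... | inj₂ 2≤m  | inj₂ 2≤m′ = inj₁ x≡y
      where
      open ≡-Reasoning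
      Bxx Byy Bxy : ℤ
      Bxx = B x x
      Byy = B y y
      Bxy = B x y
      Byy≤Bxy : pos 2 * Byy ≤ pos 2 * Bxy
      Byy≤Bxy = subst (pos 2 * Byy ≤_) (sym eq) (double≤ {m} 2≤m (nonneg y))
      Bxx≤Bxy : pos 2 * Bxx ≤ pos 2 * Bxy
      Bxx≤Bxy = subst (pos 2 * Bxx ≤_) (trans (sym eq′) (cong (pos 2 *_) (B-sym y x))) (double≤ {m′} 2≤m′ (nonneg x))
      norm : B (x ⊕ neg y) (x ⊕ neg y) ≡ Bxx + pos 2 * (- Bxy) + Byy
      norm = trans (B-⊕-square x (neg y))
        (cong₂ (λ a b → Bxx + pos 2 * a + b) (neg-homo (B-linearʳ x) y) (B-neg-neg y))
      collect : ∀ a b c → (pos 2 * c - pos 2 * a) + (pos 2 * c - pos 2 * b) ≡ - (pos 2 * (a + pos 2 * (- c) + b))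
      collect = solve-∀
      norm≤0 : B (x ⊕ neg y) (x ⊕ neg y) ≤ 0ℤ
      norm≤0 = double-nonpos (subst (λ t → pos 2 * t ≤ 0ℤ) (sym norm)
        (0≤-neg⁻ (subst (0ℤ ≤_) (collect Bxx Byy Bxy) (+-nonneg (ℤₚ.i≤j⇒0≤j-i Bxx≤Bxy) (ℤₚ.i≤j⇒0≤j-i Byy≤Bxy)))))
      x≡y : x ≡ y
      x≡y = ext λ i → ℤₚ.i-j≡0⇒i≡j (lookup x i) (lookup y i) (begin
        lookup x i + - lookup y i         ≡⟨ cong (lookup x i +_) (lookup-neg i y) ⟨
        lookup x i + lookup (neg y) i     ≡⟨ lookup-⊕ i x (neg y) ⟨
        lookup (x ⊕ neg y) i              ≡⟨ cong (λ v → lookup v i) (definite (x ⊕ neg y) norm≤0) ⟩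
        lookup 0v i                       ≡⟨ lookup-0v i ⟩
        0ℤ                                ∎)

  posRoot-sum≢ : ∀ {b c} → PosRoot b → PosRoot c → (∀ i → lookup b i + lookup c i ≡ 0ℤ) → ⊥
  posRoot-sum≢ {b} {c} (rb , 0≤b) (rc , 0≤c) b+c≡0 = root-sign-unique rb 0≤b λ i →
    subst₂ _≤_ (ℤₚ.+-identityʳ (lookup b i)) (b+c≡0 i) (ℤₚ.+-monoʳ-≤ (lookup b i) (0≤c i))

  obtuse-sum : ∀ {a c} → PosRoot a → PosRoot c → 1ℤ ≤ B a (neg c) → IsRoot (a ⊕ c)
  obtuse-sum {a} {c} (ra , 0≤a) (rc , 0≤c) 1≤B with difference ra (root-neg rc) 1≤B
  ... | inj₁ a≡-c = ⊥-elim (root-sign-unique ra 0≤a (subst NonPos (sym a≡-c) (neg-NonNeg {c} 0≤c)))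
  ... | inj₂ r    = subst (λ v → IsRoot (a ⊕ v)) (neg-involutive c) r

  acute-rest : ∀ {γ a b c} → IsRoot γ → IsRoot a → PosRoot b → PosRoot c →
               (∀ i → lookup γ i ≡ lookup a i + (lookup b i + lookup c i)) → 1ℤ ≤ B γ a → IsRoot (b ⊕ c)
  acute-rest {γ} {a} {b} {c} rγ ra pb pc γ≡ 1≤B with difference rγ ra 1≤B
  ... | inj₁ γ≡a = ⊥-elim (posRoot-sum≢ pb pc λ i → ∙-cancelˡ (lookup a i) (lookup b i + lookup c i) 0ℤ
          (trans (sym (γ≡ i)) (trans (cong (λ v → lookup v i) γ≡a) (sym (ℤₚ.+-identityʳ (lookup a i))))))
  ... | inj₂ r   = subst IsRoot (ext λ i → begin
    lookup (γ ⊕ neg a) i                                      ≡⟨ lookup-⊕ i γ (neg a) ⟩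
    lookup γ i + lookup (neg a) i                             ≡⟨ cong₂ _+_ (γ≡ i) (lookup-neg i a) ⟩
    (lookup a i + (lookup b i + lookup c i)) + - lookup a i   ≡⟨ xyx⁻¹≈y (lookup a i) (lookup b i + lookup c i) ⟩
    lookup b i + lookup c i                                   ≡⟨ lookup-⊕ i b c ⟨
    lookup (b ⊕ c) i                                          ∎) r
    where open ≡-Reasoning

  -- Otherwise B a c and B b c are ≥ 0 while B γ a and B γ b are ≤ 0 for γ = a + b + c,
  -- so that 0 ≥ B γ (a + b) ≥ B (a + b) (a + b) > 0.
  abstract
    jacobi : ∀ {a b c} → PosRoot a → PosRoot b → PosRoot c → IsRoot (a ⊕ b) → IsRoot ((a ⊕ b) ⊕ c) →
             IsRoot (a ⊕ c) ⊎ IsRoot (b ⊕ c)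
    jacobi {a} {b} {c} pa pb pc rab rγ
      with ≤0⊎1≤ (B a (neg c)) | ≤0⊎1≤ (B b (neg c)) | ≤0⊎1≤ (B ((a ⊕ b) ⊕ c) a) | ≤0⊎1≤ (B ((a ⊕ b) ⊕ c) b)
    ... | inj₂ p | _      | _      | _      = inj₁ (obtuse-sum pa pc p)
    ... | inj₁ _ | inj₂ q | _      | _      = inj₂ (obtuse-sum pb pc q)
    ... | inj₁ _ | inj₁ _ | inj₂ u | _      = inj₂ (acute-rest rγ (proj₁ pa) pb pc (λ i →
            trans (lookup-⊕ i (a ⊕ b) c) (trans (cong (_+ lookup c i) (lookup-⊕ i a b))
              (ℤₚ.+-assoc (lookup a i) (lookup b i) (lookup c i)))) u)
    ... | inj₁ _ | inj₁ _ | inj₁ _ | inj₂ v = inj₁ (acute-rest rγ (proj₁ pb) pa pc (λ i →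
            trans (lookup-⊕ i (a ⊕ b) c) (trans (cong (_+ lookup c i)
              (trans (lookup-⊕ i a b) (ℤₚ.+-comm (lookup a i) (lookup b i))))
              (ℤₚ.+-assoc (lookup b i) (lookup a i) (lookup c i)))) v)
    ... | inj₁ p | inj₁ q | inj₁ u | inj₁ v = contradiction absurd 0≰-1
      where
      open ≡-Reasoning
      σ γ : V
      σ = a ⊕ b
      γ = σ ⊕ c
      sums : B γ a + B γ b ≡ B σ σ + (- B a (neg c) + - B b (neg c))
      sums = begin
        B γ a + B γ b                                  ≡⟨ ⊕-homo (B-linearʳ γ) a b ⟨
        B γ σ                                          ≡⟨ ⊕-homo (B-linear σ) σ c ⟩
        B σ σ + B c σ                                  ≡⟨ cong (B σ σ +_) (⊕-homo (B-linearʳ c) a b) ⟩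
        B σ σ + (B c a + B c b)                        ≡⟨ cong₂ (λ x y → B σ σ + (x + y)) (flip a) (flip b) ⟩
        B σ σ + (- B a (neg c) + - B b (neg c))        ∎
        where
        flip : ∀ x → B c x ≡ - B x (neg c)
        flip x = begin
          B c x              ≡⟨ B-sym c x ⟩
          B x c              ≡⟨ ℤₚ.neg-involutive (B x c) ⟨
          - (- B x c)        ≡⟨ cong -_ (neg-homo (B-linearʳ x) c) ⟨
          - B x (neg c)      ∎
      cancel : ∀ N x y → - (N + (- x + - y)) + (- x + - y) + (N - 1ℤ) ≡ -1ℤ
      cancel = solve-∀
      absurd : 0ℤ ≤ -1ℤ
      absurd = subst (0ℤ ≤_)
        (trans (cong (λ t → - t + (- B a (neg c) + - B b (neg c)) + (B σ σ - 1ℤ)) sums)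
                 (cancel (B σ σ) (B a (neg c)) (B b (neg c))))
        (+-nonneg (+-nonneg (neg-nonneg (ℤₚ.+-mono-≤ u v)) (+-nonneg (neg-nonneg p) (neg-nonneg q)))
                  (ℤₚ.i≤j⇒0≤j-i (1≤B-root rab)))

  -- Induction on the height of a positive root.

  abstract
    -- The positive norm of `v` is the sum of the terms `lookup v i * B (e i) v`, so one of them is
    -- positive. For that `i` the product `B (e i) v` is positive, and `difference` subtracts `e i`
    -- from `v`.
    posRoot-step : ∀ {v} → PosRoot v → (∃ λ i → v ≡ e i) ⊎ (∃ λ u → ∃ λ i → PosRoot u × v ≡ u ⊕ e i)
    posRoot-step {v} (rv , 0≤v)
      with sum-positive⇒∃ (λ i → lookup v i * B (e i) v) (subst (1ℤ ≤_) (expand (B-linear v) v) (1≤B-root rv))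
    ... | i , 1≤term with difference rv (root-e i) (subst (1ℤ ≤_) (B-sym (e i) v) 1≤B)
      where
      1≤B : 1ℤ ≤ B (e i) v
      1≤B with ≤0⊎1≤ (B (e i) v)
      ... | inj₂ p = p
      ... | inj₁ p = contradiction (ℤₚ.≤-trans 1≤term (nonneg*nonpos (0≤v i) p)) 1≰0
    ...   | inj₁ v≡e = inj₁ (i , v≡e)
    ...   | inj₂ ru with root-sign ru
    ...     | inj₁ 0≤u = inj₂ (v ⊕ neg (e i) , i , (ru , 0≤u) , ext λ k → begin
      lookup v k                                        ≡⟨ restore (lookup v k) (lookup (e i) k) ⟨
      (lookup v k + - lookup (e i) k) + lookup (e i) k  ≡⟨ cong (λ t → (lookup v k + t) + lookup (e i) k) (lookup-neg k (e i)) ⟨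
      (lookup v k + lookup (neg (e i)) k) + lookup (e i) k ≡⟨ cong (_+ lookup (e i) k) (lookup-⊕ k v (neg (e i))) ⟨
      lookup (v ⊕ neg (e i)) k + lookup (e i) k         ≡⟨ lookup-⊕ k (v ⊕ neg (e i)) (e i) ⟨
      lookup ((v ⊕ neg (e i)) ⊕ e i) k                  ∎)
      where
      open ≡-Reasoning
      restore : ∀ a b → (a + - b) + b ≡ a
      restore = solve-∀
    -- Subtracting `e i` affects only the coefficient at `i`; if the result is nonpositive, all
    -- other coefficients of `v` vanish and `v` is `e i`.
    ...     | inj₂ u≤0 = inj₁ (i , axis-root i rv 0≤v λ k k≢i →
      ℤₚ.≤-antisym (subst (_≤ 0ℤ) (same k k≢i) (u≤0 k)) (0≤v k))
      where
      open ≡-Reasoning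
      same : ∀ k → k ≢ i → lookup (v ⊕ neg (e i)) k ≡ lookup v k
      same k k≢i = begin
        lookup (v ⊕ neg (e i)) k          ≡⟨ lookup-⊕ k v (neg (e i)) ⟩
        lookup v k + lookup (neg (e i)) k ≡⟨ cong (lookup v k +_) (trans (lookup-neg k (e i)) (cong -_ (lookup-e-other k≢i))) ⟩
        lookup v k + 0ℤ                   ≡⟨ ℤₚ.+-identityʳ (lookup v k) ⟩
        lookup v k                        ∎

  module _ (Q : V → Set) (simple : ∀ i → Q (e i))
           (extend : ∀ u i → PosRoot u → Q u → IsRoot (u ⊕ e i) → Q (u ⊕ e i))
           (height : V → ℤ) (height-step : ∀ u i → height (u ⊕ e i) ≡ height u + 1ℤ)
           (height-nonneg : ∀ u → NonNeg u → 0ℤ ≤ height u) where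

    private
      i≤∣i∣ : ∀ i → i ≤ pos ∣ i ∣
      i≤∣i∣ (pos m)  = ℤₚ.≤-refl
      i≤∣i∣ -[1+ m ] = -≤+

      +1≤suc⁻ : ∀ a m → a + 1ℤ ≤ pos (suc m) → a ≤ pos m
      +1≤suc⁻ (pos k)  m (+≤+ p) = +≤+ (ℕₚ.≤-pred (subst (ℕ._≤ suc m) (ℕₚ.+-comm k 1) p))
      +1≤suc⁻ -[1+ k ] m _       = -≤+

      +1≰0 : ∀ a → 0ℤ ≤ a → ¬ (a + 1ℤ ≤ 0ℤ)
      +1≰0 a 0≤a p = 1≰0 (ℤₚ.≤-trans (ℤₚ.+-monoˡ-≤ 1ℤ 0≤a) p)

      bounded-induction : ∀ m v → PosRoot v → height v ≤ pos m → Q v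
      bounded-induction m v pv hv≤m with posRoot-step pv
      ... | inj₁ (i , v≡e) = subst Q (sym v≡e) (simple i)
      bounded-induction zero v pv hv≤m | inj₂ (u , i , pu , v≡) =
        ⊥-elim (+1≰0 (height u) (height-nonneg u (proj₂ pu))
          (subst (_≤ 0ℤ) (trans (cong height v≡) (height-step u i)) hv≤m))
      bounded-induction (suc m) v pv hv≤m | inj₂ (u , i , pu , v≡) =
        subst Q (sym v≡) (extend u i pu
          (bounded-induction m u pu (+1≤suc⁻ (height u) m
            (subst (_≤ pos (suc m)) (trans (cong height v≡) (height-step u i)) hv≤m)))
          (subst IsRoot v≡ (proj₁ pv)))

    height-induction : ∀ v → PosRoot v → Q v
    height-induction v pv = bounded-induction ∣ height v ∣ v pv (i≤∣i∣ (height v))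

  posRoot-induction : (Q : V → Set) → (∀ i → Q (e i)) →
                      (∀ u i → PosRoot u → Q u → IsRoot (u ⊕ e i) → Q (u ⊕ e i)) →
                      ∀ v → PosRoot v → Q v
  posRoot-induction Q simple extend = height-induction Q simple extend (weighted (λ _ → 1ℤ))
    (λ u i → trans (⊕-homo (weighted-linear (λ _ → 1ℤ)) u (e i))
                     (cong (weighted (λ _ → 1ℤ) u +_) (weighted-e (λ _ → 1ℤ) i)))
    (λ u 0≤u → sum-nonneg (λ k → lookup u k * 1ℤ) λ k → subst (0ℤ ≤_) (sym (ℤₚ.*-identityʳ (lookup u k))) (0≤u k))

  -- The exchange condition.

  simple-flip : ∀ {v} j → PosRoot v → NonPos (s j v) → v ≡ e j
  simple-flip {v} j (rv , 0≤v) sv≤0 = axis-root j rv 0≤v λ i i≢j →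
    ℤₚ.≤-antisym (subst (_≤ 0ℤ) (lookup-s-other i≢j v) (sv≤0 i)) (0≤v i)

  -- The Cartan integers on both sides agree because `B` is invariant under `v`; the common norm
  -- `d i` of the two simple roots is nonzero and cancels.
  conjugate-reflection : ∀ v {i a} → act v (e i) ≡ e a → ∀ x → act v (s i x) ≡ s a (act v x)
  conjugate-reflection v {i} {a} ve≡ x = begin
    act v (s i x)                                   ≡⟨ cong (act v) (s≡ i x) ⟩
    act v (x ⊕ ((- pair x i) · e i))                ≡⟨ act-⊕ v x _ ⟩
    act v x ⊕ act v ((- pair x i) · e i)            ≡⟨ cong (act v x ⊕_) (trans (act-· v (- pair x i) (e i)) (cong ((- pair x i) ·_) ve≡)) ⟩
    act v x ⊕ ((- pair x i) · e a)                  ≡⟨ cong (λ t → act v x ⊕ ((- t) · e a)) pair≡ ⟩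
    act v x ⊕ ((- pair (act v x) a) · e a)          ≡⟨ s≡ a (act v x) ⟨
    s a (act v x)                                   ∎
    where
    open ≡-Reasoning
    d≡ : d i ≡ d a
    d≡ = trans (sym (B-act v (e i) (e i))) (cong (λ u → B u u) ve≡)
    d-nonZero : NonZero (d i)
    d-nonZero = ≢-nonZero λ d≡0 → 1≰0 (subst (1ℤ ≤_) d≡0 (1≤d i))
    pair≡ : pair x i ≡ pair (act v x) a
    pair≡ = ℤₚ.*-cancelʳ-≡ (pair x i) (pair (act v x) a) (d i) {{d-nonZero}} (begin
      pair x i * d i                     ≡⟨ pair-B x i ⟨
      pos 2 * B x (e i)                  ≡⟨ cong (pos 2 *_) (B-act v x (e i)) ⟨
      pos 2 * B (act v x) (act v (e i))  ≡⟨ cong (λ u → pos 2 * B (act v x) u) ve≡ ⟩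
      pos 2 * B (act v x) (e a)          ≡⟨ pair-B (act v x) a ⟩
      pair (act v x) a * d a             ≡⟨ cong (pair (act v x) a *_) d≡ ⟨
      pair (act v x) a * d i             ∎)

  -- The letter to delete is an `a` whose reflection makes the positive root `act v (e i)` negative.
  -- That root is then `e a`, so moving `s i` through `v` turns it into `s a`, which cancels against
  -- the letter.
  exchange : ∀ w i → NonPos (act w (e i)) →
             ∃ λ w′ → List.length w ≡ suc (List.length w′) × (∀ x → act w (s i x) ≡ act w′ x)
  exchange [] i e≤0 = ⊥-elim (root-sign-unique (root-e i) (e-nonneg i) e≤0)
  exchange (a ∷ v) i sve≤0 with root-sign (root-act v (root-e i))
  ... | inj₁ 0≤ve = v , refl , λ x →
        trans (cong (s a) (conjugate-reflection v (simple-flip a (root-act v (root-e i) , 0≤ve) sve≤0) x))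
                (s-involutive a (act v x))
  ... | inj₂ ve≤0 with exchange v i ve≤0
  ...   | v′ , len , eq = a ∷ v′ , cong suc len , λ x → cong (s a) (eq x)

  -- If `w` ends in the letter `i`, the word `u` before it sends `e i` to a negative root. By
  -- `exchange` the same map is then given by a word with two letters fewer, and the descent ends at
  -- the empty word.
  positive⇒identity : ∀ m w → List.length w ℕ.≤ m → (∀ i → NonNeg (act w (e i))) → ∀ x → act w x ≡ x
  positive⇒identity m w w≤m 0≤w x with initLast w
  ... | [] = refl
  ... | u ∷ʳ′ i with exchange u i (neg-NonNeg⁻ {act u (e i)} (subst NonNeg flip (0≤w i)))
    where
    flip : act (u List.++ i ∷ []) (e i) ≡ neg (act u (e i))
    flip = trans (act-++ u (i ∷ []) (e i)) (trans (cong (act u) (s-e i)) (act-neg u (e i)))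
  ...   | u′ , len , eq = shrink m w≤m
    where
    act≡ : ∀ x → act (u List.++ i ∷ []) x ≡ act u′ x
    act≡ x = trans (act-++ u (i ∷ []) x) (eq x)
    length≡ : List.length (u List.++ i ∷ []) ≡ suc (suc (List.length u′))
    length≡ = trans (Listₚ.length-++ u) (trans (ℕₚ.+-comm (List.length u) 1) (cong suc len))
    shrink : ∀ m → List.length (u List.++ i ∷ []) ℕ.≤ m → act (u List.++ i ∷ []) x ≡ x
    shrink zero    p = contradiction (subst (ℕ._≤ 0) length≡ p) λ ()
    shrink (suc m) p = trans (act≡ x)
      (positive⇒identity m u′ (ℕₚ.≤-pred (ℕₚ.<⇒≤ (subst (ℕ._≤ suc m) length≡ p)))
        (λ k → subst NonNeg (act≡ (e k)) (0≤w k)) x)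

-- Ideals and the map η

module Ideals {n : ℕ} (C : Fin n → Fin n → ℤ) (gcm : IsGCM C) (F : Lattice.InvariantForm C) where

  open RootSystem C
  open Lattice C
  open Roots C gcm F
  open Chains C gcm F
  open IsLinear

  ⊕-comm : ∀ x y → x ⊕ y ≡ y ⊕ x
  ⊕-comm = Vecₚ.zipWith-comm ℤₚ.+-comm

  ⊕-assoc : ∀ x y z → (x ⊕ y) ⊕ z ≡ x ⊕ (y ⊕ z)
  ⊕-assoc = Vecₚ.zipWith-assoc ℤₚ.+-assoc

  neg-⊕ : ∀ x y → neg (x ⊕ y) ≡ neg x ⊕ neg y
  neg-⊕ x y = ext λ i → begin
    lookup (neg (x ⊕ y)) i               ≡⟨ lookup-neg i (x ⊕ y) ⟩
    - lookup (x ⊕ y) i                   ≡⟨ cong -_ (lookup-⊕ i x y) ⟩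
    - (lookup x i + lookup y i)          ≡⟨ ℤₚ.neg-distrib-+ (lookup x i) (lookup y i) ⟩
    - lookup x i + - lookup y i          ≡⟨ cong₂ _+_ (lookup-neg i x) (lookup-neg i y) ⟨
    lookup (neg x) i + lookup (neg y) i  ≡⟨ lookup-⊕ i (neg x) (neg y) ⟨
    lookup (neg x ⊕ neg y) i             ∎
    where open ≡-Reasoning

  ⊕-nonneg : ∀ x y → NonNeg x → NonNeg y → NonNeg (x ⊕ y)
  ⊕-nonneg x y 0≤x 0≤y i = subst (0ℤ ≤_) (sym (lookup-⊕ i x y)) (+-nonneg (0≤x i) (0≤y i))

  posRoot-⊕ : ∀ {x y} → PosRoot x → PosRoot y → IsRoot (x ⊕ y) → PosRoot (x ⊕ y)
  posRoot-⊕ {x} {y} (_ , 0≤x) (_ , 0≤y) r = r , ⊕-nonneg x y 0≤x 0≤y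

  posRoot-neg : ∀ {v} → IsRoot v → NonPos v → PosRoot (neg v)
  posRoot-neg {v} rv v≤0 = root-neg rv , neg-NonPos {v} v≤0

  ¬posRoot-neg : ∀ {v} → PosRoot v → ¬ PosRoot (neg v)
  ¬posRoot-neg {v} (rv , 0≤v) (_ , 0≤-v) = root-sign-unique rv 0≤v (neg-NonNeg⁻ {v} 0≤-v)

  posRoot-coordinate : ∀ {v} i → IsRoot v → 1ℤ ≤ lookup v i → PosRoot v
  posRoot-coordinate i rv 1≤vᵢ with root-sign rv
  ... | inj₁ 0≤v = rv , 0≤v
  ... | inj₂ v≤0 = contradiction (ℤₚ.≤-trans 1≤vᵢ (v≤0 i)) 1≰0

  -- Both summands are supported at `j`, hence both equal `e j`, and the coefficient 1 of `e j`
  -- would be 1 + 1.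
  simple-indecomposable : ∀ {x y} j → PosRoot x → PosRoot y → x ⊕ y ≢ e j
  simple-indecomposable {x} {y} j (rx , 0≤x) (ry , 0≤y) eq =
    contradiction (trans (sym (cong₂ _+_ (on-axis x x≡e) (on-axis y y≡e))) (trans (sum≡ j) (lookup-e-same j))) λ ()
    where
    sum≡ : ∀ i → lookup x i + lookup y i ≡ lookup (e j) i
    sum≡ i = trans (sym (lookup-⊕ i x y)) (cong (λ v → lookup v i) eq)
    x≡e : x ≡ e j
    x≡e = axis-root j rx 0≤x λ i i≢j → nonneg-sum≡0ˡ (0≤x i) (0≤y i) (trans (sum≡ i) (lookup-e-other i≢j))
    y≡e : y ≡ e j
    y≡e = axis-root j ry 0≤y λ i i≢j → nonneg-sum≡0ˡ (0≤y i) (0≤x i)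
      (trans (ℤₚ.+-comm (lookup y i) (lookup x i)) (trans (sum≡ i) (lookup-e-other i≢j)))
    on-axis : ∀ v → v ≡ e j → lookup v j ≡ 1ℤ
    on-axis v v≡e = trans (cong (λ u → lookup u j) v≡e) (lookup-e-same j)

  gen-split : ∀ {J γ} → Gen J γ → J γ ⊎ (∃ λ β → ∃ λ δ → J β × Gen J δ × γ ≡ β ⊕ δ)
  gen-split (base Jγ)    = inj₁ Jγ
  gen-split (add Jβ gδ _) = inj₂ (_ , _ , Jβ , gδ , refl)

  gen-posRoot : ∀ {J} → (∀ {γ} → J γ → PosRoot γ) → ∀ {γ} → Gen J γ → PosRoot γ
  gen-posRoot J⊆Δ⁺ (base Jγ)     = J⊆Δ⁺ Jγ
  gen-posRoot J⊆Δ⁺ (add Jβ gδ r) = posRoot-⊕ (J⊆Δ⁺ Jβ) (gen-posRoot J⊆Δ⁺ gδ) r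

  -- Applied to the inverse of `w` and to its negative, this carries roots generated at level -1 of
  -- a functional back to roots generated in degree 1.
  gen-map : ∀ {J K : V → Set} (ψ : V → V) → (∀ x y → ψ (x ⊕ y) ≡ ψ x ⊕ ψ y) → (∀ {x} → IsRoot x → IsRoot (ψ x)) →
            (∀ {γ} → J γ → K (ψ γ)) → ∀ {γ} → Gen J γ → Gen K (ψ γ)
  gen-map ψ ψ-⊕ ψ-root J→K (base Jγ) = base (J→K Jγ)
  gen-map {K = K} ψ ψ-⊕ ψ-root J→K (add {β} {δ} Jβ gδ r) = subst (Gen K) (sym (ψ-⊕ β δ))
    (add (J→K Jβ) (gen-map ψ ψ-⊕ ψ-root J→K gδ) (subst IsRoot (ψ-⊕ β δ) (ψ-root r)))

  -- Roots generated at level -1 of an additive function.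

  module _ (f : V → ℤ) (f-⊕ : ∀ x y → f (x ⊕ y) ≡ f x + f y) where

    MinusOne : V → Set
    MinusOne v = PosRoot v × f v ≡ -1ℤ

    private
      minusOne : ∀ {v} → PosRoot v → f v ≤ -1ℤ → -1ℤ ≤ f v → MinusOne v
      minusOne pv f≤ ≤f = pv , ℤₚ.≤-antisym f≤ ≤f

    -- Induction on the derivation of `ν`; for `β ⊕ δ`, `jacobi` tells which summand absorbs `θ`.
    -- When `δ ⊕ θ` is a root, either it is generated by induction, or its level is nonnegative and
    -- the whole sum already has level -1.
    gen-⊕ : ∀ {ν θ} → Gen MinusOne ν → PosRoot θ → 0ℤ ≤ f θ → IsRoot (ν ⊕ θ) → f (ν ⊕ θ) ≤ -1ℤ →
            Gen MinusOne (ν ⊕ θ)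
    gen-⊕ {ν} {θ} (base (pν , fν≡)) pθ 0≤fθ r f≤ = base (minusOne (posRoot-⊕ pν pθ r) f≤
      (subst (-1ℤ ≤_) (sym (trans (f-⊕ ν θ) (cong (_+ f θ) fν≡))) (i≤i+j -1ℤ 0≤fθ)))
    gen-⊕ {θ = θ} (add {β} {δ} (pβ , fβ≡) gδ rν) pθ 0≤fθ r f≤
      with jacobi pβ (gen-posRoot proj₁ gδ) pθ rν r
    ... | inj₂ rδθ = via-δ (≤-1⊎0≤ (f (δ ⊕ θ)))
      where
      pγ : PosRoot ((β ⊕ δ) ⊕ θ)
      pγ = posRoot-⊕ (posRoot-⊕ pβ (gen-posRoot proj₁ gδ) rν) pθ r
      f-total : f ((β ⊕ δ) ⊕ θ) ≡ -1ℤ + f (δ ⊕ θ)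
      f-total = trans (cong f (⊕-assoc β δ θ)) (trans (f-⊕ β (δ ⊕ θ)) (cong (_+ f (δ ⊕ θ)) fβ≡))
      via-δ : f (δ ⊕ θ) ≤ -1ℤ ⊎ 0ℤ ≤ f (δ ⊕ θ) → Gen MinusOne ((β ⊕ δ) ⊕ θ)
      via-δ (inj₁ f≤-1) = subst (Gen MinusOne) (sym (⊕-assoc β δ θ))
        (add (pβ , fβ≡) (gen-⊕ gδ pθ 0≤fθ rδθ f≤-1) (subst IsRoot (⊕-assoc β δ θ) r))
      via-δ (inj₂ 0≤f) = base (minusOne pγ f≤ (subst (-1ℤ ≤_) (sym f-total) (i≤i+j -1ℤ 0≤f)))
    ... | inj₁ rβθ = via-β (≤-1⊎0≤ (f (β ⊕ θ)))
      where
      pβθ : PosRoot (β ⊕ θ)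
      pβθ = posRoot-⊕ pβ pθ rβθ
      swap-δθ : (β ⊕ δ) ⊕ θ ≡ (β ⊕ θ) ⊕ δ
      swap-δθ = trans (⊕-assoc β δ θ) (trans (cong (β ⊕_) (⊕-comm δ θ)) (sym (⊕-assoc β θ δ)))
      swap-all : (β ⊕ δ) ⊕ θ ≡ δ ⊕ (β ⊕ θ)
      swap-all = trans swap-δθ (⊕-comm (β ⊕ θ) δ)
      via-β : f (β ⊕ θ) ≤ -1ℤ ⊎ 0ℤ ≤ f (β ⊕ θ) → Gen MinusOne ((β ⊕ δ) ⊕ θ)
      -- Since `f θ ≥ 0`, the level of `β ⊕ θ` is exactly -1, and this root replaces the generator
      -- `β`.
      via-β (inj₁ f≤-1) = subst (Gen MinusOne) (sym swap-δθ)
        (add (minusOne pβθ f≤-1 (subst (-1ℤ ≤_) (sym (trans (f-⊕ β θ) (cong (_+ f θ) fβ≡))) (i≤i+j -1ℤ 0≤fθ)))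
             gδ (subst IsRoot swap-δθ r))
      -- Now `β ⊕ θ` has nonnegative level, so it takes the place of `θ` and is added to the shorter
      -- derivation of `δ`.
      via-β (inj₂ 0≤f) = subst (Gen MinusOne) (sym swap-all)
        (gen-⊕ gδ pβθ 0≤f (subst IsRoot swap-all r) (subst (λ v → f v ≤ -1ℤ) swap-all f≤))

    -- Adding a simple root `e i` to `u` splits by the two levels. If `e i` has level -1, it is
    -- either a further generator or, when `f u ≥ 0`, the sum itself has level -1. If its level is
    -- nonnegative, `gen-⊕` absorbs it, and two nonnegative levels cannot have a negative sum.
    negative⇒gen : (∀ i → -1ℤ ≤ f (e i)) → ∀ v → PosRoot v → f v ≤ -1ℤ → Gen MinusOne v
    negative⇒gen -1≤f = posRoot-induction (λ v → f v ≤ -1ℤ → Gen MinusOne v)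
      (λ i f≤ → base (minusOne (posRoot-e i) f≤ (-1≤f i))) extend
      where
      extend : ∀ u i → PosRoot u → (f u ≤ -1ℤ → Gen MinusOne u) → IsRoot (u ⊕ e i) →
               f (u ⊕ e i) ≤ -1ℤ → Gen MinusOne (u ⊕ e i)
      extend u i pu ih r f≤ with ≤-1⊎0≤ (f (e i)) | ≤-1⊎0≤ (f u)
      ... | inj₂ 0≤fe | inj₁ fu≤-1 = gen-⊕ (ih fu≤-1) (posRoot-e i) 0≤fe r f≤
      ... | inj₂ 0≤fe | inj₂ 0≤fu  = contradiction
            (ℤₚ.≤-trans (+-nonneg 0≤fu 0≤fe) (subst (_≤ -1ℤ) (f-⊕ u (e i)) f≤)) 0≰-1
      ... | inj₁ fe≤-1 | inj₁ fu≤-1 = subst (Gen MinusOne) (⊕-comm (e i) u)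
            (add (minusOne (posRoot-e i) fe≤-1 (-1≤f i)) (ih fu≤-1) (subst IsRoot (⊕-comm u (e i)) r))
      ... | inj₁ fe≤-1 | inj₂ 0≤fu = base (minusOne (posRoot-⊕ pu (posRoot-e i) r) f≤
            (subst (-1ℤ ≤_) (sym (f-⊕ u (e i))) (ℤₚ.+-mono-≤ 0≤fu (-1≤f i))))

  -- The grading and the map `η`.

  module Grading (p : Fin n) where

    open Graded p

    deg : V → ℤ
    deg v = lookup v p

    deg⁻¹-linear : ∀ w → IsLinear (λ v → deg (act (inv w) v))
    deg⁻¹-linear w = linear-act (lookup-linear p) (inv w)

    k≡⇒deg≡ : ∀ w w′ → η w ≡ η w′ → ∀ v → deg (act (inv w) v) ≡ deg (act (inv w′) v)
    k≡⇒deg≡ w w′ η≡ = linear-ext (deg⁻¹-linear w) (deg⁻¹-linear w′) λ i →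
      trans (sym (Vecₚ.lookup∘tabulate (λ α → k α w) i))
        (trans (cong (λ v → lookup v i) η≡) (Vecₚ.lookup∘tabulate (λ α → k α w′) i))

    etaInjective : EtaInjective
    etaInjective w w′ w∈W0 w′∈W0 η≡ v = begin
      act w v                          ≡⟨ act-invʳ w′ (act w v) ⟨
      act w′ (act (inv w′) (act w v))  ≡⟨ cong (act w′) (act-++ (inv w′) w v) ⟨
      act w′ (act u v)                 ≡⟨ cong (act w′) (positive⇒identity (List.length u) u ℕₚ.≤-refl u-positive v) ⟩
      act w′ v                         ∎
      where
      open ≡-Reasoning
      u : Word
      u = inv w′ List.++ w
      deg-u : ∀ x → deg (act u x) ≡ deg x
      deg-u x = begin
        deg (act u x)                   ≡⟨ cong deg (act-++ (inv w′) w x) ⟩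
        deg (act (inv w′) (act w x))    ≡⟨ k≡⇒deg≡ w w′ η≡ (act w x) ⟨
        deg (act (inv w) (act w x))     ≡⟨ cong deg (act-invˡ w x) ⟩
        deg x                           ∎
      w′u : ∀ x → act w′ (act u x) ≡ act w x
      w′u x = trans (cong (act w′) (act-++ (inv w′) w x)) (act-invʳ w′ (act w x))
      u-positive : ∀ i → NonNeg (act u (e i))
      u-positive i with root-sign (root-act u (root-e i))
      ... | inj₁ 0≤ue = 0≤ue
      -- A nonpositive image forces the preserved degree of `e i` to be 0. So `w` keeps `e i`
      -- positive and `w′` keeps `neg (act u (e i))` positive, but the second image is the negative
      -- of the first.
      ... | inj₂ ue≤0 = ⊥-elim (¬posRoot-neg (w∈W0 (e i) (posRoot-e i , deg-e≡0)) (subst PosRoot w′-ue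
              (w′∈W0 (neg (act u (e i))) (posRoot-neg (root-act u (root-e i)) ue≤0 , deg-ue≡0))))
        where
        deg-e≡0 : deg (e i) ≡ 0ℤ
        deg-e≡0 = ℤₚ.≤-antisym (subst (_≤ 0ℤ) (deg-u (e i)) (ue≤0 p)) (e-nonneg i p)
        deg-ue≡0 : deg (neg (act u (e i))) ≡ 0ℤ
        deg-ue≡0 = trans (lookup-neg p (act u (e i))) (cong -_ (trans (deg-u (e i)) deg-e≡0))
        w′-ue : act w′ (neg (act u (e i))) ≡ neg (act w (e i))
        w′-ue = trans (act-neg w′ (act u (e i))) (cong neg (w′u (e i)))

    Δ1-posRoot : ∀ {γ} → Δ1 γ → PosRoot γ
    Δ1-posRoot (rγ , deg≡1) = posRoot-coordinate p rγ (ℤₚ.≤-reflexive (sym deg≡1))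

    gen-deg : ∀ {J} → (∀ {γ} → J γ → Δ1 γ) → ∀ {γ} → Gen J γ → 1ℤ ≤ deg γ
    gen-deg J⊆Δ1 (base Jγ) = ℤₚ.≤-reflexive (sym (proj₂ (J⊆Δ1 Jγ)))
    gen-deg J⊆Δ1 (add {β} {δ} Jβ gδ r) = subst (1ℤ ≤_) (sym (lookup-⊕ p β δ))
      (ℤₚ.≤-trans (ℤₚ.≤-reflexive (sym (proj₂ (J⊆Δ1 Jβ)))) (i≤i+j (deg β) (1≤⇒0≤ (gen-deg J⊆Δ1 gδ))))

    gen-decompose : ∀ {J γ} → (∀ {γ} → J γ → Δ1 γ) → pos 2 ≤ deg γ → Gen J γ →
                    ∃ λ β → ∃ λ δ → J β × Gen J δ × γ ≡ β ⊕ δ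
    gen-decompose J⊆Δ1 2≤deg g with gen-split g
    ... | inj₁ Jγ = contradiction (subst (pos 2 ≤_) (proj₂ (J⊆Δ1 Jγ)) 2≤deg) 2≰1
    ... | inj₂ split = split

    N-add : ∀ w {β δ} → N w β → N w δ → IsRoot (β ⊕ δ) → N w (β ⊕ δ)
    N-add w {β} {δ} (pβ , pwβ) (pδ , pwδ) r = posRoot-⊕ pβ pδ r ,
      root-neg (root-act w r) , subst NonNeg (sym (trans (cong neg (act-⊕ w β δ)) (neg-⊕ (act w β) (act w δ))))
        (⊕-nonneg (neg (act w β)) (neg (act w δ)) (proj₂ pwβ) (proj₂ pwδ))

    -- Together with `1≤deg⇒W0`, this turns membership in W⁰ into a condition on the inversions
    -- alone.
    W0⇒1≤deg : ∀ w → InW0 w → ∀ {γ} → N w γ → 1ℤ ≤ deg γ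
    W0⇒1≤deg w w∈W0 {γ} (pγ , pwγ) with ≤0⊎1≤ (deg γ)
    ... | inj₂ 1≤deg = 1≤deg
    ... | inj₁ deg≤0 = ⊥-elim (¬posRoot-neg (w∈W0 γ (pγ , ℤₚ.≤-antisym deg≤0 (proj₂ pγ p))) pwγ)

    1≤deg⇒W0 : ∀ w → (∀ {γ} → N w γ → 1ℤ ≤ deg γ) → InW0 w
    1≤deg⇒W0 w 1≤deg α (pα , deg≡0) with root-sign (root-act w (proj₁ pα))
    ... | inj₁ 0≤wα = root-act w (proj₁ pα) , 0≤wα
    ... | inj₂ wα≤0 = contradiction
          (subst (1ℤ ≤_) deg≡0 (1≤deg (pα , posRoot-neg (root-act w (proj₁ pα)) wα≤0))) 1≰0

    -- This set serves as the ideal attached to `w` both in the minimal and in the maximal case.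
    Inversions1 : Word → V → Set
    Inversions1 w γ = N w γ × deg γ ≡ 1ℤ

    inversions1-Δ1 : ∀ w {γ} → Inversions1 w γ → Δ1 γ
    inversions1-Δ1 w (nγ , deg≡1) = proj₁ (proj₁ nγ) , deg≡1

    -- γ − μ has degree 0, so it involves only simple roots that w keeps positive.
    inversions1-lower : ∀ w → InW0 w → LowerIdeal (Inversions1 w)
    inversions1-lower w w∈W0 = (λ γ → inversions1-Δ1 w) , lower
      where
      lower : ∀ μ γ → Δ1 μ → Inversions1 w γ → μ ≼ γ → Inversions1 w μ
      lower μ γ (rμ , degμ≡1) ((pγ , pwγ) , degγ≡1) μ≼γ =
        (Δ1-posRoot (rμ , degμ≡1) , posRoot-neg (root-act w rμ) wμ≤0) , degμ≡1
        where
        open ≡-Reasoning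
        ε = γ ⊕ neg μ
        lookup-ε : ∀ i → lookup ε i ≡ lookup γ i - lookup μ i
        lookup-ε i = trans (lookup-⊕ i γ (neg μ)) (cong (lookup γ i +_) (lookup-neg i μ))
        term : ∀ l i → 0ℤ ≤ lookup ε i * lookup (act w (e i)) l
        term l i with i ≟ p
        ... | no i≢p   = *-nonneg {lookup ε i} (subst (0ℤ ≤_) (sym (lookup-ε i)) (ℤₚ.i≤j⇒0≤j-i (μ≼γ i)))
                           (proj₂ (w∈W0 (e i) (posRoot-e i , lookup-e-other (i≢p ∘ sym))) l)
        ... | yes refl = subst (0ℤ ≤_) (sym (trans (cong (_* lookup (act w (e p)) l)
                           (trans (lookup-ε p) (cong₂ _-_ degγ≡1 degμ≡1))) (ℤₚ.*-zeroˡ (lookup (act w (e p)) l)))) ℤₚ.≤-refl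
        0≤wε : NonNeg (act w ε)
        0≤wε l = subst (0ℤ ≤_) (sym (expand (linear-act (lookup-linear l) w) ε))
          (sum-nonneg (λ i → lookup ε i * lookup (act w (e i)) l) (term l))
        wε : ∀ l → lookup (act w ε) l ≡ lookup (act w γ) l - lookup (act w μ) l
        wε l = trans (⊕-homo L γ (neg μ)) (cong (lookup (act w γ) l +_) (neg-homo L μ))
          where L = linear-act (lookup-linear l) w
        wμ≤0 : NonPos (act w μ)
        wμ≤0 l = ℤₚ.≤-trans (ℤₚ.0≤i-j⇒j≤i (subst (0ℤ ≤_) (wε l) (0≤wε l))) (neg-NonNeg⁻ {act w γ} (proj₂ pwγ) l)

    -- If `k α w ≤ -2`, the negative `ν` of the preimage of `e α` is an inversion of degree at least
    -- 2, hence a sum of inversions `β` and `δ`. Applying `w` and negating writes `e α` as a sum of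
    -- two positive roots.
    isMin⇒k≥-1 : ∀ {I} w → LowerIdeal I → IsMinFor w I → ∀ α → -1ℤ ≤ k α w
    isMin⇒k≥-1 {I} w (I⊆Δ1 , _) isMin α with -1≤⊎2≤- (k α w)
    ... | inj₁ p = p
    ... | inj₂ 2≤ = ⊥-elim (impossible (gen-decompose {I} {ν} (I⊆Δ1 _) 2≤deg (proj₁ (isMin ν) (pν , pwν))))
      where
      open ≡-Reasoning
      ν : V
      ν = neg (act (inv w) (e α))
      2≤deg : pos 2 ≤ deg ν
      2≤deg = subst (pos 2 ≤_) (sym (lookup-neg p (act (inv w) (e α)))) 2≤
      pν : PosRoot ν
      pν = posRoot-coordinate p (root-neg (root-act (inv w) (root-e α))) (ℤₚ.≤-trans (+≤+ (ℕ.s≤s ℕ.z≤n)) 2≤deg)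
      -wν : neg (act w ν) ≡ e α
      -wν = begin
        neg (act w ν)                              ≡⟨ act-neg w ν ⟨
        act w (neg ν)                              ≡⟨ cong (act w) (neg-involutive (act (inv w) (e α))) ⟩
        act w (act (inv w) (e α))                  ≡⟨ act-invʳ w (e α) ⟩
        e α                                        ∎
      pwν : PosRoot (neg (act w ν))
      pwν = subst PosRoot (sym -wν) (posRoot-e α)
      impossible : (∃ λ β → ∃ λ δ → I β × Gen I δ × ν ≡ β ⊕ δ) → ⊥
      impossible (β , δ , Iβ , gδ , ν≡) = simple-indecomposable α
        (proj₂ (proj₂ (isMin β) (base Iβ))) (proj₂ (proj₂ (isMin δ) gδ)) (begin
          neg (act w β) ⊕ neg (act w δ)    ≡⟨ neg-⊕ (act w β) (act w δ) ⟨
          neg (act w β ⊕ act w δ)          ≡⟨ cong neg (act-⊕ w β δ) ⟨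
          neg (act w (β ⊕ δ))              ≡⟨ cong (neg ∘ act w) ν≡ ⟨
          neg (act w ν)                    ≡⟨ -wν ⟩
          e α                              ∎)

    -- With `f` the degree after undoing `w`, an inversion `γ` gives the positive root
    -- `neg (act w γ)` of level `- deg γ`, at most -1. It is generated by roots of level -1; `ψ`
    -- turns these into inversions of degree 1 and the whole sum back into `γ`.
    k≥-1⇒isMin : ∀ w → InW0 w → (∀ α → -1ℤ ≤ k α w) → IsMinFor w (Inversions1 w)
    k≥-1⇒isMin w w∈W0 -1≤k γ = to , from
      where
      open ≡-Reasoning
      ψ : V → V
      ψ v = neg (act (inv w) v)
      ψ-⊕ : ∀ x y → ψ (x ⊕ y) ≡ ψ x ⊕ ψ y
      ψ-⊕ x y = trans (cong neg (act-⊕ (inv w) x y)) (neg-⊕ (act (inv w) x) (act (inv w) y))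
      ψ-root : ∀ {x} → IsRoot x → IsRoot (ψ x)
      ψ-root rx = root-neg (root-act (inv w) rx)
      -wψ : ∀ x → neg (act w (ψ x)) ≡ x
      -wψ x = begin
        neg (act w (neg (act (inv w) x)))    ≡⟨ act-neg w (neg (act (inv w) x)) ⟨
        act w (neg (neg (act (inv w) x)))    ≡⟨ cong (act w) (neg-involutive (act (inv w) x)) ⟩
        act w (act (inv w) x)                ≡⟨ act-invʳ w x ⟩
        x                                    ∎
      f : V → ℤ
      f v = deg (act (inv w) v)
      f-⊕ : ∀ x y → f (x ⊕ y) ≡ f x + f y
      f-⊕ = ⊕-homo (deg⁻¹-linear w)
      minusOne⇒inversion : ∀ {x} → MinusOne f f-⊕ x → Inversions1 w (ψ x)
      minusOne⇒inversion {x} (px , fx≡) = (pψ , subst PosRoot (sym (-wψ x)) px) , deg≡1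
        where
        deg≡1 : deg (ψ x) ≡ 1ℤ
        deg≡1 = trans (lookup-neg p (act (inv w) x)) (cong -_ fx≡)
        pψ : PosRoot (ψ x)
        pψ = Δ1-posRoot (ψ-root (proj₁ px) , deg≡1)
      ν : V
      ν = neg (act w γ)
      ψν : ψ ν ≡ γ
      ψν = begin
        neg (act (inv w) (neg (act w γ)))    ≡⟨ act-neg (inv w) (neg (act w γ)) ⟨
        act (inv w) (neg (neg (act w γ)))    ≡⟨ cong (act (inv w)) (neg-involutive (act w γ)) ⟩
        act (inv w) (act w γ)                ≡⟨ act-invˡ w γ ⟩
        γ                                    ∎
      fν : f ν ≡ - deg γ
      fν = trans (neg-homo (deg⁻¹-linear w) (act w γ)) (cong (-_ ∘ deg) (act-invˡ w γ))
      to : N w γ → Gen (Inversions1 w) γ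
      to nγ = subst (Gen (Inversions1 w)) ψν (gen-map ψ ψ-⊕ ψ-root minusOne⇒inversion
        (negative⇒gen f f-⊕ -1≤k ν (proj₂ nγ) (subst (_≤ -1ℤ) (sym fν) (ℤₚ.neg-mono-≤ (W0⇒1≤deg w w∈W0 nγ)))))
      from : ∀ {γ} → Gen (Inversions1 w) γ → N w γ
      from (base (nγ , _))       = nγ
      from (add (nβ , _) gδ r)   = N-add w nβ (from gδ) r

    -- If `k α w ≥ 2`, the preimage `μ` of `e α` has degree at least 2. It is not generated by the
    -- complement of `I`: `w` keeps generated roots positive, and `e α` would be a sum of two
    -- positive roots. Then `isMax` makes `μ` an inversion, although `w` sends it to `e α`.
    isMax⇒k≤1 : ∀ {I} w → IsMaxFor w I → ∀ α → k α w ≤ 1ℤ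
    isMax⇒k≤1 {I} w isMax α with ≤1⊎2≤ (k α w)
    ... | inj₁ p = p
    ... | inj₂ 2≤deg = ⊥-elim (¬posRoot-neg (subst PosRoot (sym wμ) (posRoot-e α))
            (proj₂ (proj₂ (isMax μ) ((proj₁ pμ , 1≤deg) , ¬gen))))
      where
      open ≡-Reasoning
      μ : V
      μ = act (inv w) (e α)
      wμ : act w μ ≡ e α
      wμ = act-invʳ w (e α)
      1≤deg : 1ℤ ≤ deg μ
      1≤deg = ℤₚ.≤-trans (+≤+ (ℕ.s≤s ℕ.z≤n)) 2≤deg
      pμ : PosRoot μ
      pμ = posRoot-coordinate p (root-act (inv w) (root-e α)) 1≤deg
      w-positive : ∀ {β} → Gen (Compl I) β → PosRoot (act w β)
      w-positive {β} gβ with gen-posRoot (Δ1-posRoot ∘ proj₁) gβ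
      ... | pβ with root-sign (root-act w (proj₁ pβ))
      ...   | inj₁ 0≤wβ = root-act w (proj₁ pβ) , 0≤wβ
      ...   | inj₂ wβ≤0 = ⊥-elim (proj₂ (proj₁ (isMax β) (pβ , posRoot-neg (root-act w (proj₁ pβ)) wβ≤0)) gβ)
      ¬gen : ¬ Gen (Compl I) μ
      ¬gen gμ with gen-decompose proj₁ 2≤deg gμ
      ... | β , δ , Kβ , gδ , μ≡ = simple-indecomposable α (w-positive (base Kβ)) (w-positive gδ) (begin
        act w β ⊕ act w δ    ≡⟨ act-⊕ w β δ ⟨
        act w (β ⊕ δ)        ≡⟨ cong (act w) μ≡ ⟨
        act w μ              ≡⟨ wμ ⟩
        e α                  ∎)

    -- Here `f` is minus the degree after undoing `w`. A root `γ` of positive degree kept positive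
    -- by `w` gives the positive root `act w γ` of level at most -1, and the roots of level -1 come
    -- from roots of degree 1 outside `Inversions1 w`.
    k≤1⇒isMax : ∀ w → InW0 w → (∀ α → k α w ≤ 1ℤ) → IsMaxFor w (Inversions1 w)
    k≤1⇒isMax w w∈W0 k≤1 γ = to , from
      where
      open ≡-Reasoning
      K : V → Set
      K = Compl (Inversions1 w)
      f : V → ℤ
      f v = - deg (act (inv w) v)
      f-⊕ : ∀ x y → f (x ⊕ y) ≡ f x + f y
      f-⊕ x y = trans (cong -_ (⊕-homo (deg⁻¹-linear w) x y))
        (ℤₚ.neg-distrib-+ (deg (act (inv w) x)) (deg (act (inv w) y)))
      w-positive : ∀ {β} → Gen K β → PosRoot (act w β)
      w-positive (base {β} (β∈Δ1 , β∉I)) with root-sign (root-act w (proj₁ β∈Δ1))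
      ... | inj₁ 0≤wβ = root-act w (proj₁ β∈Δ1) , 0≤wβ
      ... | inj₂ wβ≤0 = contradiction
            ((Δ1-posRoot β∈Δ1 , posRoot-neg (root-act w (proj₁ β∈Δ1)) wβ≤0) , proj₂ β∈Δ1) β∉I
      w-positive (add {β} {δ} Kβ gδ r) = subst PosRoot (sym (act-⊕ w β δ))
        (posRoot-⊕ (w-positive (base Kβ)) (w-positive gδ) (subst IsRoot (act-⊕ w β δ) (root-act w r)))
      minusOne⇒K : ∀ {x} → MinusOne f f-⊕ x → K (act (inv w) x)
      minusOne⇒K {x} (px , fx≡) = (root-act (inv w) (proj₁ px) , deg≡1) ,
        λ (nx , _) → ¬posRoot-neg (subst PosRoot (sym (act-invʳ w x)) px) (proj₂ nx)
        where
        deg≡1 : deg (act (inv w) x) ≡ 1ℤ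
        deg≡1 = trans (sym (ℤₚ.neg-involutive (deg (act (inv w) x)))) (cong -_ fx≡)
      to : N w γ → Δ≥1 γ × ¬ Gen K γ
      to nγ = (proj₁ (proj₁ nγ) , W0⇒1≤deg w w∈W0 nγ) , λ gγ → ¬posRoot-neg (w-positive gγ) (proj₂ nγ)
      from : Δ≥1 γ × ¬ Gen K γ → N w γ
      -- The sign of `act w γ` decides whether `γ` is an inversion; `¬gγ` enters in refuting the
      -- positive sign.
      from ((rγ , 1≤deg) , ¬gγ) with root-sign (root-act w rγ)
      ... | inj₂ wγ≤0 = posRoot-coordinate p rγ 1≤deg , posRoot-neg (root-act w rγ) wγ≤0
      ... | inj₁ 0≤wγ = contradiction (subst (Gen K) (act-invˡ w γ)
            (gen-map (act (inv w)) (act-⊕ (inv w)) (root-act (inv w)) minusOne⇒K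
              (negative⇒gen f f-⊕ (λ i → ℤₚ.neg-mono-≤ (k≤1 i)) (act w γ) (root-act w rγ , 0≤wγ)
                (subst (_≤ -1ℤ) (cong (-_ ∘ deg) (sym (act-invˡ w γ))) (ℤₚ.neg-mono-≤ 1≤deg))))) ¬gγ

    etaMin : EtaMin
    etaMin κ =
      (λ (I , lower , w , isMin , η≡) → w ,
        1≤deg⇒W0 w (λ {γ} nγ → gen-deg (proj₁ lower _) (proj₁ (isMin γ) nγ)) , isMin⇒k≥-1 w lower isMin , η≡) ,
      (λ (w , w∈W0 , -1≤k , η≡) → Inversions1 w , inversions1-lower w w∈W0 , w , k≥-1⇒isMin w w∈W0 -1≤k , η≡)

    etaMax : EtaMax
    etaMax κ =
      (λ (I , lower , w , isMax , η≡) → w ,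
        1≤deg⇒W0 w (λ {γ} nγ → proj₂ (proj₁ (proj₁ (isMax γ) nγ))) , isMax⇒k≤1 w isMax , η≡) ,
      (λ (w , w∈W0 , k≤1 , η≡) → Inversions1 w , inversions1-lower w w∈W0 , w , k≤1⇒isMax w w∈W0 k≤1 , η≡)

theorem3p14 : (n : ℕ) (C : Fin n → Fin n → ℤ) → IsGCM C → Indecomposable C →
    RootSystem.FiniteRoots C → (p : Fin n) →
    RootSystem.Graded.EtaInjective C p
    × RootSystem.Graded.EtaMin C p
    × RootSystem.Graded.EtaMax C p
theorem3p14 n C gcm _ finite p = etaInjective , etaMin , etaMax
  where
  open Ideals C gcm (Lattice.invariantForm C (IsGCM.diag gcm) finite)
  open Grading p
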